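{- Let $c$ and $r$ be fixed integers with $r\ge1$, and let $q,Z,z$ be indeterminates. For $n\ge0$ let $$L_q(-n,c,r)(z)=\sum_{\substack{m\ge1\\ m\equiv c\ (\mathrm{mod}\ r)}}[m]_q^n\,z^m ,$$ and let $\mu_n\in\mathbb{Q}(q,Z)$ be the $n$th moment of the shifted little $q$-Jacobi polynomials $p_n\big(q^{ -c}(1+(q-1)x);\,Zq^{ -r},\,1\mid q^r\big)$, $n\geq 0$. Then for every $n\ge0$ $$\frac{L_q(-n,c,r)(z)}{L_q(0,c,r)(z)}=\mu_n\big|_{Z=z^r}.$$
   Context: Notation: $[m]_q=\frac{1-q^m}{1-q}$, and $(a;q)_n=(1-a)(1-aq)\cdots(1-aq^{n-1})$. $L_q(-n,c,r)(z)$ is the value on the power series $f(z)=z$ of the operator $L_q(s,c,r)=\sum_{m\ge1,\ m\equiv c\,(\mathrm{mod}\ r)}\frac{1}{[m]_q^s}F_m$ at $s=-n$, where $F_m(f)(q,z)=f(q^m,z^m)$ acts on formal power series in $z$ without constant term over $\mathbb{Q}(q)$; this gives the displayed series. It is a formal power series in $z$ over $\mathbb{Q}(q)$ (and is in fact the expansion of a rational function in $q$ and $z$). Little $q$-Jacobi polynomials (with base $q$): $$p_n(x;a,b\mid q)=\sum_{k=0}^{\infty}\frac{(q^{ -n};q)_k\,(abq^{n+1};q)_k}{(aq;q)_k\,(q;q)_k}(qx)^k ,$$ where the terms with $k>n$ vanish; in $p_n(x;a,b\mid q^r)$ every $q$ in this formula is replaced by $q^r$. Moments: write $P_n(x)=p_n(q^{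 -c}(1+(q-1)x);Zq^{ -r},1\mid q^r)\in\mathbb{Q}(q,Z)[x]$. The $n$th moment is $\mu_n=\varphi(x^n)$, where $\varphi:\mathbb{Q}(q,Z)[x]\to\mathbb{Q}(q,Z)$ is the unique linear functional with $\varphi(1)=1$ and $\varphi(P_nP_m)=K_n\delta_{n,m}$, $K_n\ne0$, for all $n,m\ge0$.
   Formalization: The formal theorem assumes 1 ≤ c ≤ r instead of an arbitrary integer c; for other c the identity fails already at n = 1 (e.g. c = 0, r = 1: the moment is z/(1−qz), while the quotient of the L-series is 1/(1−qz)). -}

module Defs where

open import Algebra.Bundles using (CommutativeRing; Semiring; Ring)
import Algebra.Definitions.RawMonoid as RawMonoidOps
import Algebra.Definitions.RawSemiring as RawSemiringOps
open import Algebra.Module.Bundles.Raw using (RawLeftModule)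
import Algebra.Module.Construct.TensorUnit as TensorUnit
open import Algebra.Module.Morphism.Structures using (module LeftModuleMorphisms)
import Algebra.Properties.Ring as RingProperties
import Algebra.Properties.Semiring.Sum as SemiringSum
import Algebra.Solver.Ring.NaturalCoefficients.Default as NatCoeffSolver
open import Algebra.Structures using (IsCommutativeRing)
open import Data.Bool.Base using (if_then_else_)
open import Data.Empty using (⊥-elim)
open import Data.Fin.Base using (Fin; toℕ)
open import Data.Fin.Properties using (toℕ<n)
open import Data.Integer.Base as ℤ using (ℤ; +_; -[1+_])
import Data.Integer.Properties as ℤP
open import Data.Nat.Base as ℕ using (ℕ; zero; suc; z≤n; s≤s; NonZero)
import Data.Nat.Divisibility as ℕ∣
import Data.Nat.DivMod as ℕ/
open import Data.Nat.Induction using (<-rec)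
import Data.Nat.Properties as ℕP
import Data.Nat.Solver as ℕSolver
open import Data.Product.Base using (_,_; ∃; proj₁; proj₂)
open import Data.Rational.Base as ℚ using (ℚ; 0ℚ; 1ℚ)
import Data.Rational.Properties as ℚP
open import Data.Sum.Base using (_⊎_; inj₁; inj₂)
open import Level using (Level; _⊔_; 0ℓ) renaming (suc to lsuc)
open import Relation.Binary.PropositionalEquality as ≡ using (_≡_; module ≡-Reasoning)
import Relation.Binary.Reasoning.Setoid as SetoidReasoning
open import Relation.Nullary.Decidable.Core using (Dec; yes; no; does; map′)
open import Relation.Nullary.Decidable using (dec-true)
open import Relation.Nullary.Negation.Core using (¬_)

private
  variable
    a ℓ : Level

------------------------------------------------------------------------
-- Integral domains and discrete fields

record IsIntegralDomain (R : CommutativeRing a ℓ) : Set (a ⊔ ℓ) where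
  open CommutativeRing R
  field
    1≉0            : ¬ (1# ≈ 0#)
    noZeroDivisors : ∀ x y → x * y ≈ 0# → ¬ (y ≈ 0#) → x ≈ 0#

-- The inverse is total, with the convention 0 ⁻¹ = 0.
record DiscreteField a ℓ : Set (lsuc (a ⊔ ℓ)) where
  no-eta-equality
  field
    commutativeRing : CommutativeRing a ℓ
  open CommutativeRing commutativeRing public
  infix  4 _≟_
  infix  8 _⁻¹
  field
    _≟_       : ∀ x y → Dec (x ≈ y)
    1≉0       : ¬ (1# ≈ 0#)
    _⁻¹       : Carrier → Carrier
    ⁻¹-cong   : ∀ {x y} → x ≈ y → x ⁻¹ ≈ y ⁻¹
    0⁻¹≈0     : 0# ⁻¹ ≈ 0#
    *-inverse : ∀ x → ¬ (x ≈ 0#) → x * x ⁻¹ ≈ 1#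

  open RawMonoidOps *-rawMonoid public using () renaming (sum to product)
  open RawSemiringOps (Semiring.rawSemiring semiring) public using (_^_; sum)

  infixr 8 _^ℤ_
  _^ℤ_ : Carrier → ℤ → Carrier
  x ^ℤ (+ n)    = x ^ n
  x ^ℤ -[1+ n ] = (x ^ suc n) ⁻¹

  isIntegralDomain : IsIntegralDomain commutativeRing
  isIntegralDomain = record
    { 1≉0            = 1≉0
    ; noZeroDivisors = λ x y xy≈0 y≉0 → begin
        x                ≈⟨ *-identityʳ x ⟨
        x * 1#           ≈⟨ *-congˡ (*-inverse y y≉0) ⟨
        x * (y * y ⁻¹)   ≈⟨ *-assoc x y (y ⁻¹) ⟨
        (x * y) * y ⁻¹   ≈⟨ *-congʳ xy≈0 ⟩
        0# * y ⁻¹        ≈⟨ zeroˡ (y ⁻¹) ⟩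
        0#               ∎
    }
    where open SetoidReasoning setoid

ℚ-field : DiscreteField 0ℓ 0ℓ
DiscreteField.commutativeRing ℚ-field = ℚP.+-*-commutativeRing
DiscreteField._≟_             ℚ-field = ℚP._≟_
DiscreteField.1≉0             ℚ-field = λ ()
DiscreteField._⁻¹             ℚ-field p with p ℚP.≟ 0ℚ
... | yes _  = 0ℚ
... | no p≢0 = ℚ.1/_ p {{ℚ.≢-nonZero p≢0}}
DiscreteField.⁻¹-cong         ℚ-field = ≡.cong (DiscreteField._⁻¹ ℚ-field)
DiscreteField.0⁻¹≈0           ℚ-field = ≡.refl
DiscreteField.*-inverse       ℚ-field p p≢0 with p ℚP.≟ 0ℚ
... | yes p≡0 = ⊥-elim (p≢0 p≡0)
... | no p≢0′ = ℚP.*-inverseʳ p {{ℚ.≢-nonZero p≢0′}}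

------------------------------------------------------------------------
-- Formal power series

module PowerSeries (R : CommutativeRing a ℓ) where
  open CommutativeRing R
  open SemiringSum semiring
  open SetoidReasoning setoid

  Series : Set a
  Series = ℕ → Carrier

  infix 4 _≋_
  record _≋_ (f g : Series) : Set ℓ where
    constructor coeffwise
    field at : ∀ n → f n ≈ g n
  open _≋_ public

  convolution : Series → Series → Series
  convolution f g n = sum {suc n} (λ i → f (toℕ i) * g (n ℕ.∸ toℕ i))

  one : Series
  one zero    = 1#
  one (suc _) = 0#

  -- f(z) ↦ f(zʳ)
  dilate : (r : ℕ) .{{_ : NonZero r}} → Series → Series
  dilate r f n = if does (r ℕ∣.∣? n) then f (n ℕ./ r) else 0#

  sum-0 : ∀ {n} (t : Fin n → Carrier) → (∀ i → t i ≈ 0#) → sum t ≈ 0#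
  sum-0 {n} t t≈0 = trans (sum-cong-≋ t≈0) (sum-replicate-zero n)

  private
    tail : Series → Series
    tail f n = f (suc n)

    conv-cong : ∀ {f f′ g g′} → (∀ n → f n ≈ f′ n) → (∀ n → g n ≈ g′ n) →
                ∀ n → convolution f g n ≈ convolution f′ g′ n
    conv-cong f≈ g≈ n = sum-cong-≋ {suc n} (λ i → *-cong (f≈ (toℕ i)) (g≈ (n ℕ.∸ toℕ i)))

    conv-distribʳ : ∀ h f g n →
      convolution (λ i → f i + g i) h n ≈ convolution f h n + convolution g h n
    conv-distribʳ h f g n = trans
      (sum-cong-≋ {suc n} (λ i → distribʳ (h (n ℕ.∸ toℕ i)) (f (toℕ i)) (g (toℕ i))))
      (∑-distrib-+ (λ i → f (toℕ {suc n} i) * h (n ℕ.∸ toℕ i))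
                   (λ i → g (toℕ {suc n} i) * h (n ℕ.∸ toℕ i)))

    conv-scale : ∀ x f g n → convolution (λ i → x * f i) g n ≈ x * convolution f g n
    conv-scale x f g n = trans
      (sum-cong-≋ {suc n} (λ i → *-assoc x (f (toℕ i)) (g (n ℕ.∸ toℕ i))))
      (sym (*-distribˡ-sum x (λ i → f (toℕ {suc n} i) * g (n ℕ.∸ toℕ i))))

    conv-sucʳ : ∀ f g n → convolution f g (suc n) ≈ convolution f (tail g) n + f (suc n) * g 0
    conv-sucʳ f g zero = begin
      f 0 * g 1 + (f 1 * g 0 + 0#)   ≈⟨ +-congˡ (+-identityʳ _) ⟩
      f 0 * g 1 + f 1 * g 0          ≈⟨ +-congʳ (+-identityʳ _) ⟨
      (f 0 * g 1 + 0#) + f 1 * g 0   ∎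
    conv-sucʳ f g (suc n) = begin
      f 0 * g (suc (suc n)) + convolution (tail f) g (suc n)
        ≈⟨ +-congˡ (conv-sucʳ (tail f) g n) ⟩
      f 0 * g (suc (suc n)) + (convolution (tail f) (tail g) n + f (suc (suc n)) * g 0)
        ≈⟨ +-assoc _ _ _ ⟨
      convolution f (tail g) (suc n) + f (suc (suc n)) * g 0 ∎

    conv-comm : ∀ f g n → convolution f g n ≈ convolution g f n
    conv-comm f g zero    = +-congʳ (*-comm (f 0) (g 0))
    conv-comm f g (suc n) = begin
      f 0 * g (suc n) + convolution (tail f) g n   ≈⟨ +-cong (*-comm _ _) (conv-comm (tail f) g n) ⟩
      g (suc n) * f 0 + convolution g (tail f) n   ≈⟨ +-comm _ _ ⟩
      convolution g (tail f) n + g (suc n) * f 0   ≈⟨ conv-sucʳ g f n ⟨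
      convolution g f (suc n)                      ∎

    conv-assoc : ∀ f g h n → convolution (convolution f g) h n ≈ convolution f (convolution g h) n
    conv-assoc f g h zero = +-congʳ (begin
      (f 0 * g 0 + 0#) * h 0   ≈⟨ *-congʳ (+-identityʳ _) ⟩
      (f 0 * g 0) * h 0        ≈⟨ *-assoc _ _ _ ⟩
      f 0 * (g 0 * h 0)        ≈⟨ *-congˡ (+-identityʳ _) ⟨
      f 0 * (g 0 * h 0 + 0#)   ∎)
    conv-assoc f g h (suc n) = begin
      (f 0 * g 0 + 0#) * h (suc n) + convolution (λ i → f 0 * g (suc i) + convolution (tail f) g i) h n
        ≈⟨ +-cong (*-congʳ (+-identityʳ _))
                  (conv-distribʳ h (λ i → f 0 * g (suc i)) (convolution (tail f) g) n) ⟩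
      (f 0 * g 0) * h (suc n) + (convolution (λ i → f 0 * g (suc i)) h n + convolution (convolution (tail f) g) h n)
        ≈⟨ +-cong (*-assoc _ _ _) (+-cong (conv-scale (f 0) (tail g) h n) (conv-assoc (tail f) g h n)) ⟩
      f 0 * (g 0 * h (suc n)) + (f 0 * convolution (tail g) h n + convolution (tail f) (convolution g h) n)
        ≈⟨ +-assoc _ _ _ ⟨
      (f 0 * (g 0 * h (suc n)) + f 0 * convolution (tail g) h n) + convolution (tail f) (convolution g h) n
        ≈⟨ +-congʳ (distribˡ _ _ _) ⟨
      convolution f (convolution g h) (suc n) ∎

    conv-identityˡ : ∀ f n → convolution one f n ≈ f n
    conv-identityˡ f n = begin
      1# * f n + sum {n} (λ i → 0# * f (n ℕ.∸ suc (toℕ i)))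
        ≈⟨ +-cong (*-identityˡ _) (sum-0 {n} _ (λ i → zeroˡ _)) ⟩
      f n + 0#   ≈⟨ +-identityʳ _ ⟩
      f n        ∎

  abstract
    seriesIsCommutativeRing : IsCommutativeRing _≋_ (λ f g n → f n + g n) convolution (λ f n → - f n) (λ _ → 0#) one
    seriesIsCommutativeRing = record
      { isRing = record
        { +-isAbelianGroup = record
          { isGroup = record
            { isMonoid = record
              { isSemigroup = record
                { isMagma = record
                  { isEquivalence = record
                    { refl  = coeffwise (λ _ → refl)
                    ; sym   = λ p → coeffwise (λ n → sym (at p n))
                    ; trans = λ p q → coeffwise (λ n → trans (at p n) (at q n))
                    }
                  ; ∙-cong = λ p q → coeffwise (λ n → +-cong (at p n) (at q n))
                  }
                ; assoc = λ f g h → coeffwise (λ n → +-assoc (f n) (g n) (h n))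
                }
              ; identity = (λ f → coeffwise (λ n → +-identityˡ (f n)))
                         , (λ f → coeffwise (λ n → +-identityʳ (f n)))
              }
            ; inverse = (λ f → coeffwise (λ n → -‿inverseˡ (f n)))
                      , (λ f → coeffwise (λ n → -‿inverseʳ (f n)))
            ; ⁻¹-cong = λ p → coeffwise (λ n → -‿cong (at p n))
            }
          ; comm = λ f g → coeffwise (λ n → +-comm (f n) (g n))
          }
        ; *-cong     = λ p q → coeffwise (conv-cong (at p) (at q))
        ; *-assoc    = λ f g h → coeffwise (conv-assoc f g h)
        ; *-identity = (λ f → coeffwise (conv-identityˡ f))
                     , (λ f → coeffwise (λ n → trans (conv-comm f one n) (conv-identityˡ f n)))
        ; distrib    = (λ f g h → coeffwise (λ n → begin
                           convolution f (λ i → g i + h i) n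
                             ≈⟨ conv-comm f (λ i → g i + h i) n ⟩
                           convolution (λ i → g i + h i) f n
                             ≈⟨ conv-distribʳ f g h n ⟩
                           convolution g f n + convolution h f n
                             ≈⟨ +-cong (conv-comm g f n) (conv-comm h f n) ⟩
                           convolution f g n + convolution f h n ∎))
                     , (λ f g h → coeffwise (conv-distribʳ f g h))
        }
      ; *-comm = λ f g → coeffwise (conv-comm f g)
      }

  seriesRing : CommutativeRing a ℓ
  seriesRing = record
    { Carrier = Series
    ; _≈_     = _≋_
    ; _+_     = λ f g n → f n + g n
    ; _*_     = convolution
    ; -_      = λ f n → - f n
    ; 0#      = λ _ → 0#
    ; 1#      = one
    ; isCommutativeRing = seriesIsCommutativeRing
    }

  dilate-* : ∀ r .{{_ : NonZero r}} f n → dilate r f (n ℕ.* r) ≡ f n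
  dilate-* r f n rewrite dec-true (r ℕ∣.∣? (n ℕ.* r)) (ℕ∣.n∣m*n n) = ≡.cong f (ℕ/.m*n/n≡m n r)

  dilate≉0 : ∀ r .{{_ : NonZero r}} f → ¬ (f ≋ λ _ → 0#) → ¬ (dilate r f ≋ λ _ → 0#)
  dilate≉0 r f f≉0 p = f≉0 (coeffwise λ n →
    trans (reflexive (≡.sym (dilate-* r f n))) (at p (n ℕ.* r)))

  -- The product of the leading terms is the leading term of the product.
  leading-* : ∀ k j f g → (∀ {i} → i ℕ.< k → f i ≈ 0#) → (∀ {i} → i ℕ.< j → g i ≈ 0#) →
              convolution f g (k ℕ.+ j) ≈ f k * g j
  leading-* zero j f g _ g≈0 = begin
    f 0 * g j + sum {j} (λ i → f (suc (toℕ i)) * g (j ℕ.∸ suc (toℕ i)))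
      ≈⟨ +-congˡ (sum-0 {j} _ (λ i →
           trans (*-congˡ (g≈0 (ℕP.∸-monoʳ-< (s≤s z≤n) (toℕ<n i)))) (zeroʳ _))) ⟩
    f 0 * g j + 0#   ≈⟨ +-identityʳ _ ⟩
    f 0 * g j        ∎
  leading-* (suc k) j f g f≈0 g≈0 = begin
    f 0 * g (suc (k ℕ.+ j)) + convolution (tail f) g (k ℕ.+ j)
      ≈⟨ +-cong (trans (*-congʳ (f≈0 (s≤s z≤n))) (zeroˡ _))
                (leading-* k j (tail f) g (λ i<k → f≈0 (s≤s i<k)) g≈0) ⟩
    0# + f (suc k) * g j   ≈⟨ +-identityˡ _ ⟩
    f (suc k) * g j        ∎

  module _ (dom : IsIntegralDomain R) (_≟_ : ∀ x y → Dec (x ≈ y)) where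
    open IsIntegralDomain dom

    abstract
      seriesDomain : IsIntegralDomain seriesRing
      seriesDomain = record
        { 1≉0            = λ p → 1≉0 (at p 0)
        ; noZeroDivisors = λ f g fg≈0 g≉0 → coeffwise
            (<-rec (λ k → f k ≈ 0#) (λ k f<k≈0 → coeff≈0 f g fg≈0 g≉0 k f<k≈0 (f k ≟ 0#)))
        }
        where
        coeff≈0 : ∀ f g → convolution f g ≋ (λ _ → 0#) → ¬ (g ≋ λ _ → 0#) →
                  ∀ k → (∀ {i} → i ℕ.< k → f i ≈ 0#) → Dec (f k ≈ 0#) → f k ≈ 0#
        coeff≈0 f g fg≈0 g≉0 k f<k≈0 (yes fk≈0) = fk≈0
        coeff≈0 f g fg≈0 g≉0 k f<k≈0 (no fk≉0)  = ⊥-elim (g≉0 (coeffwise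
          (<-rec (λ j → g j ≈ 0#) (λ j g<j≈0 →
            noZeroDivisors (g j) (f k)
              (begin
                g j * f k                   ≈⟨ *-comm _ _ ⟩
                f k * g j                   ≈⟨ leading-* k j f g f<k≈0 g<j≈0 ⟨
                convolution f g (k ℕ.+ j)   ≈⟨ at fg≈0 (k ℕ.+ j) ⟩
                0#                          ∎)
              fk≉0))))

------------------------------------------------------------------------
-- Polynomials in one indeterminate: power series with a bound beyond
-- which all coefficients vanish.  The bound need not be sharp and is
-- ignored by equality.

module Polynomials (R : CommutativeRing a ℓ) where
  open CommutativeRing R
  open PowerSeries R
  private module S = CommutativeRing seriesRing

  record Polynomial : Set (a ⊔ ℓ) where
    constructor poly
    no-eta-equality
    field
      coeff  : ℕ → Carrier
      bound  : ℕ
      vanish : ∀ n → bound ℕ.≤ n → coeff n ≈ 0#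
  open Polynomial public

  infix 4 _≈ₚ_
  record _≈ₚ_ (p q : Polynomial) : Set ℓ where
    constructor poly≈
    field series≈ : coeff p ≋ coeff q
  open _≈ₚ_ public

  infixl 6 _+ₚ_
  infixl 7 _*ₚ_ _•_

  _+ₚ_ : Polynomial → Polynomial → Polynomial
  coeff  (p +ₚ q)       = coeff p S.+ coeff q
  bound  (p +ₚ q)       = bound p ℕ.+ bound q
  vanish (p +ₚ q) n b≤n = trans
    (+-cong (vanish p n (ℕP.≤-trans (ℕP.m≤m+n _ _) b≤n))
            (vanish q n (ℕP.≤-trans (ℕP.m≤n+m _ (bound p)) b≤n)))
    (+-identityˡ 0#)

  _*ₚ_ : Polynomial → Polynomial → Polynomial
  coeff  (p *ₚ q)       = coeff p S.* coeff q
  bound  (p *ₚ q)       = bound p ℕ.+ bound q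
  vanish (p *ₚ q) n b≤n =
    sum-0 {suc n} _ (λ i → term≈0 (toℕ i) (ℕP.≤-total (bound p) (toℕ i)))
    where
    term≈0 : ∀ i → (bound p ℕ.≤ i) ⊎ (i ℕ.≤ bound p) → coeff p i * coeff q (n ℕ.∸ i) ≈ 0#
    term≈0 i (inj₁ b≤i) = trans (*-congʳ (vanish p i b≤i)) (zeroˡ _)
    term≈0 i (inj₂ i≤b) = trans (*-congˡ (vanish q (n ℕ.∸ i)
      (ℕP.m+n≤o⇒m≤o∸n _ (ℕP.≤-trans (ℕP.+-monoʳ-≤ (bound q) i≤b)
        (ℕP.≤-trans (ℕP.≤-reflexive (ℕP.+-comm (bound q) (bound p))) b≤n))))) (zeroʳ _)

  -ₚ_ : Polynomial → Polynomial
  coeff  (-ₚ p)       = S.- coeff p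
  bound  (-ₚ p)       = bound p
  vanish (-ₚ p) n b≤n = trans (-‿cong (vanish p n b≤n)) -0#≈0#
    where open RingProperties ring using (-0#≈0#)

  _•_ : Carrier → Polynomial → Polynomial
  coeff  (x • p) n     = x * coeff p n
  bound  (x • p)       = bound p
  vanish (x • p) n b≤n = trans (*-congˡ (vanish p n b≤n)) (zeroʳ x)

  const : Carrier → Polynomial
  coeff  (const x) zero          = x
  coeff  (const x) (suc _)       = 0#
  bound  (const x)               = 1
  vanish (const x) (suc _) _     = refl

  0ₚ 1ₚ X : Polynomial
  coeff  0ₚ     = S.0#
  bound  0ₚ     = 0
  vanish 0ₚ _ _ = refl

  coeff  1ₚ           = S.1#
  bound  1ₚ           = 1
  vanish 1ₚ (suc _) _ = refl

  coeff  X zero                = 0#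
  coeff  X (suc zero)          = 1#
  coeff  X (suc (suc _))       = 0#
  bound  X                     = 2
  vanish X (suc zero) (s≤s ())
  vanish X (suc (suc _)) _     = refl

  abstract
    polynomialIsCommutativeRing : IsCommutativeRing _≈ₚ_ _+ₚ_ _*ₚ_ -ₚ_ 0ₚ 1ₚ
    polynomialIsCommutativeRing = record
      { isRing = record
        { +-isAbelianGroup = record
          { isGroup = record
            { isMonoid = record
              { isSemigroup = record
                { isMagma = record
                  { isEquivalence = record
                    { refl  = poly≈ S.refl
                    ; sym   = λ p → poly≈ (S.sym (series≈ p))
                    ; trans = λ p q → poly≈ (S.trans (series≈ p) (series≈ q))
                    }
                  ; ∙-cong = λ p q → poly≈ (S.+-cong (series≈ p) (series≈ q))
                  }
                ; assoc = λ p q r → poly≈ (S.+-assoc (coeff p) (coeff q) (coeff r))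
                }
              ; identity = (λ p → poly≈ (S.+-identityˡ (coeff p)))
                         , (λ p → poly≈ (S.+-identityʳ (coeff p)))
              }
            ; inverse = (λ p → poly≈ (S.-‿inverseˡ (coeff p)))
                      , (λ p → poly≈ (S.-‿inverseʳ (coeff p)))
            ; ⁻¹-cong = λ p → poly≈ (S.-‿cong (series≈ p))
            }
          ; comm = λ p q → poly≈ (S.+-comm (coeff p) (coeff q))
          }
        ; *-cong     = λ p q → poly≈ (S.*-cong (series≈ p) (series≈ q))
        ; *-assoc    = λ p q r → poly≈ (S.*-assoc (coeff p) (coeff q) (coeff r))
        ; *-identity = (λ p → poly≈ (S.*-identityˡ (coeff p)))
                     , (λ p → poly≈ (S.*-identityʳ (coeff p)))
        ; distrib    = (λ p q r → poly≈ (S.distribˡ (coeff p) (coeff q) (coeff r)))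
                     , (λ p q r → poly≈ (S.distribʳ (coeff p) (coeff q) (coeff r)))
        }
      ; *-comm = λ p q → poly≈ (S.*-comm (coeff p) (coeff q))
      }

  polynomialRing : CommutativeRing (a ⊔ ℓ) ℓ
  polynomialRing = record
    { Carrier = Polynomial
    ; _≈_     = _≈ₚ_
    ; _+_     = _+ₚ_
    ; _*_     = _*ₚ_
    ; -_      = -ₚ_
    ; 0#      = 0ₚ
    ; 1#      = 1ₚ
    ; isCommutativeRing = polynomialIsCommutativeRing
    }

  rawLeftModule : RawLeftModule Carrier (a ⊔ ℓ) ℓ
  rawLeftModule = record
    { _≈ᴹ_ = _≈ₚ_
    ; _+ᴹ_ = _+ₚ_
    ; _*ₗ_ = _•_
    ; 0ᴹ   = 0ₚ
    ; -ᴹ_  = -ₚ_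
    }

  module _ (dom : IsIntegralDomain R) (_≟_ : ∀ x y → Dec (x ≈ y)) where

    abstract
      polynomialDomain : IsIntegralDomain polynomialRing
      polynomialDomain = record
        { 1≉0            = λ p → D.1≉0 (series≈ p)
        ; noZeroDivisors = λ p q pq≈0 q≉0 → poly≈
            (D.noZeroDivisors (coeff p) (coeff q) (series≈ pq≈0) (λ q≈0 → q≉0 (poly≈ q≈0)))
        }
        where module D = IsIntegralDomain (seriesDomain dom _≟_)

      polynomial-≟ : ∀ p q → Dec (p ≈ₚ q)
      polynomial-≟ p q = map′ {A = Agree}
        (λ below → poly≈ (coeffwise (λ n → everywhere below n (ℕP.<-≤-connex n b))))
        (λ p≈q → λ {n} _ → at (series≈ p≈q) n)
        (ℕP.allUpTo? (λ n → coeff p n ≟ coeff q n) b)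
        where
        b : ℕ
        b = bound p ℕ.+ bound q

        Agree : Set ℓ
        Agree = ∀ {n} → n ℕ.< b → coeff p n ≈ coeff q n

        everywhere : Agree → ∀ n → (n ℕ.< b) ⊎ (b ℕ.≤ n) → coeff p n ≈ coeff q n
        everywhere below n (inj₁ n<b) = below n<b
        everywhere below n (inj₂ b≤n) = trans
          (vanish p n (ℕP.≤-trans (ℕP.m≤m+n _ _) b≤n))
          (sym (vanish q n (ℕP.≤-trans (ℕP.m≤n+m _ (bound p)) b≤n)))

------------------------------------------------------------------------
-- Fields of fractions

module Fractions (R : CommutativeRing a ℓ) (dom : IsIntegralDomain R) where
  open CommutativeRing R
  open IsIntegralDomain dom
  open SetoidReasoning setoid
  open NatCoeffSolver commutativeSemiring using (solve; _:=_; _:+_; _:*_)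

  record Fraction : Set (a ⊔ ℓ) where
    constructor frac
    no-eta-equality
    field
      num   : Carrier
      den   : Carrier
      den≉0 : ¬ (den ≈ 0#)
  open Fraction public

  infix 4 _≈ᶠ_
  record _≈ᶠ_ (x y : Fraction) : Set ℓ where
    constructor cross
    field cross≈ : num x * den y ≈ num y * den x
  open _≈ᶠ_ public

  embed : Carrier → Fraction
  num   (embed x) = x
  den   (embed x) = 1#
  den≉0 (embed x) = 1≉0

  *≉0 : ∀ {x y} → ¬ (x ≈ 0#) → ¬ (y ≈ 0#) → ¬ (x * y ≈ 0#)
  *≉0 {x} {y} x≉0 y≉0 xy≈0 = x≉0 (noZeroDivisors x y xy≈0 y≉0)

  *-cancelʳ : ∀ {x y} z → ¬ (z ≈ 0#) → x * z ≈ y * z → x ≈ y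
  *-cancelʳ {x} {y} z z≉0 xz≈yz = begin
    x                 ≈⟨ +-identityʳ x ⟨
    x + 0#            ≈⟨ +-congˡ (-‿inverseˡ y) ⟨
    x + (- y + y)     ≈⟨ +-assoc x (- y) y ⟨
    (x + - y) + y     ≈⟨ +-congʳ (noZeroDivisors (x + - y) z diff≈0 z≉0) ⟩
    0# + y            ≈⟨ +-identityˡ y ⟩
    y                 ∎
    where
    diff≈0 : (x + - y) * z ≈ 0#
    diff≈0 = begin
      (x + - y) * z     ≈⟨ distribʳ z x (- y) ⟩
      x * z + - y * z   ≈⟨ +-congʳ xz≈yz ⟩
      y * z + - y * z   ≈⟨ distribʳ z y (- y) ⟨
      (y + - y) * z     ≈⟨ *-congʳ (-‿inverseʳ y) ⟩
      0# * z            ≈⟨ zeroˡ z ⟩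
      0#                ∎

  infixl 6 _+ᶠ_
  infixl 7 _*ᶠ_

  _+ᶠ_ _*ᶠ_ : Fraction → Fraction → Fraction
  num   (x +ᶠ y) = num x * den y + num y * den x
  den   (x +ᶠ y) = den x * den y
  den≉0 (x +ᶠ y) = *≉0 (den≉0 x) (den≉0 y)
  num   (x *ᶠ y) = num x * num y
  den   (x *ᶠ y) = den x * den y
  den≉0 (x *ᶠ y) = *≉0 (den≉0 x) (den≉0 y)

  -ᶠ_ : Fraction → Fraction
  num   (-ᶠ x) = - num x
  den   (-ᶠ x) = den x
  den≉0 (-ᶠ x) = den≉0 x

  private
    trans-lemma : ∀ a b c d e f → ¬ (d ≈ 0#) → a * d ≈ c * b → c * f ≈ e * d → a * f ≈ e * b
    trans-lemma a b c d e f d≉0 p q = *-cancelʳ d d≉0 (begin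
      (a * f) * d   ≈⟨ solve 3 (λ a d f → (a :* f) :* d := (a :* d) :* f) refl a d f ⟩
      (a * d) * f   ≈⟨ *-congʳ p ⟩
      (c * b) * f   ≈⟨ solve 3 (λ b c f → (c :* b) :* f := (c :* f) :* b) refl b c f ⟩
      (c * f) * b   ≈⟨ *-congʳ q ⟩
      (e * d) * b   ≈⟨ solve 3 (λ b d e → (e :* d) :* b := (e :* b) :* d) refl b d e ⟩
      (e * b) * d   ∎)

    +-lemma : ∀ a b c d a′ b′ c′ d′ → a * b′ ≈ a′ * b → c * d′ ≈ c′ * d →
              (a * d + c * b) * (b′ * d′) ≈ (a′ * d′ + c′ * b′) * (b * d)
    +-lemma a b c d a′ b′ c′ d′ p q = begin
      (a * d + c * b) * (b′ * d′)
        ≈⟨ solve 6 (λ a b c d b′ d′ → (a :* d :+ c :* b) :* (b′ :* d′)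
                    := (a :* b′) :* (d :* d′) :+ (c :* d′) :* (b :* b′)) refl a b c d b′ d′ ⟩
      (a * b′) * (d * d′) + (c * d′) * (b * b′)
        ≈⟨ +-cong (*-congʳ p) (*-congʳ q) ⟩
      (a′ * b) * (d * d′) + (c′ * d) * (b * b′)
        ≈⟨ solve 6 (λ a′ b c′ d b′ d′ → (a′ :* b) :* (d :* d′) :+ (c′ :* d) :* (b :* b′)
                    := (a′ :* d′ :+ c′ :* b′) :* (b :* d)) refl a′ b c′ d b′ d′ ⟩
      (a′ * d′ + c′ * b′) * (b * d) ∎

    interchange : ∀ a b c d → (a * b) * (c * d) ≈ (a * c) * (b * d)
    interchange = solve 4 (λ a b c d → (a :* b) :* (c :* d) := (a :* c) :* (b :* d)) refl

    +-assoc-lemma : ∀ a b c d e f →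
      (a * d + c * b) * f + e * (b * d) ≈ a * (d * f) + (c * f + e * d) * b
    +-assoc-lemma = solve 6 (λ a b c d e f → (a :* d :+ c :* b) :* f :+ e :* (b :* d)
      := a :* (d :* f) :+ (c :* f :+ e :* d) :* b) refl

    distrib-lemma : ∀ a b c d e f →
      ((a * d + c * b) * e) * ((b * f) * (d * f)) ≈ ((a * e) * (d * f) + (c * e) * (b * f)) * ((b * d) * f)
    distrib-lemma = solve 6 (λ a b c d e f → ((a :* d :+ c :* b) :* e) :* ((b :* f) :* (d :* f))
      := ((a :* e) :* (d :* f) :+ (c :* e) :* (b :* f)) :* ((b :* d) :* f)) refl

    ≈ᶠ-sym : ∀ {x y} → x ≈ᶠ y → y ≈ᶠ x
    ≈ᶠ-sym (cross p) = cross (sym p)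

    ≈ᶠ-trans : ∀ {x y z} → x ≈ᶠ y → y ≈ᶠ z → x ≈ᶠ z
    ≈ᶠ-trans {x} {y} {z} (cross p) (cross q) = cross
      (trans-lemma (num x) (den x) (num y) (den y) (num z) (den z) (den≉0 y) p q)

    +ᶠ-cong : ∀ {x x′ y y′} → x ≈ᶠ x′ → y ≈ᶠ y′ → x +ᶠ y ≈ᶠ x′ +ᶠ y′
    +ᶠ-cong {x} {x′} {y} {y′} (cross p) (cross q) = cross
      (+-lemma (num x) (den x) (num y) (den y) (num x′) (den x′) (num y′) (den y′) p q)

    *ᶠ-cong : ∀ {x x′ y y′} → x ≈ᶠ x′ → y ≈ᶠ y′ → x *ᶠ y ≈ᶠ x′ *ᶠ y′
    *ᶠ-cong {x} {x′} {y} {y′} (cross p) (cross q) = cross (begin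
      (num x * num y) * (den x′ * den y′)   ≈⟨ interchange _ _ _ _ ⟩
      (num x * den x′) * (num y * den y′)   ≈⟨ *-cong p q ⟩
      (num x′ * den x) * (num y′ * den y)   ≈⟨ interchange _ _ _ _ ⟩
      (num x′ * num y′) * (den x * den y)   ∎)

    -ᶠ-cong : ∀ {x y} → x ≈ᶠ y → (-ᶠ x) ≈ᶠ (-ᶠ y)
    -ᶠ-cong {x} {y} (cross p) = cross (begin
      - num x * den y     ≈⟨ -‿distribˡ-* _ _ ⟨
      - (num x * den y)   ≈⟨ -‿cong p ⟩
      - (num y * den x)   ≈⟨ -‿distribˡ-* _ _ ⟩
      - num y * den x     ∎)
      where open RingProperties ring using (-‿distribˡ-*)

    fraction≈ : ∀ {x y} → num x ≈ num y → den x ≈ den y → x ≈ᶠ y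
    fraction≈ p q = cross (*-cong p (sym q))

    -ᶠ-inverseˡ : ∀ x → (-ᶠ x) +ᶠ x ≈ᶠ embed 0#
    -ᶠ-inverseˡ x = cross (begin
      (- num x * den x + num x * den x) * 1#   ≈⟨ *-identityʳ _ ⟩
      - num x * den x + num x * den x          ≈⟨ distribʳ _ _ _ ⟨
      (- num x + num x) * den x                ≈⟨ *-congʳ (-‿inverseˡ _) ⟩
      0# * den x                               ≈⟨ zeroˡ _ ⟩
      0#                                       ≈⟨ zeroˡ _ ⟨
      0# * (den x * den x)                     ∎)

    +ᶠ-comm : ∀ x y → x +ᶠ y ≈ᶠ y +ᶠ x
    +ᶠ-comm _ _ = fraction≈ (+-comm _ _) (*-comm _ _)

    *ᶠ-comm : ∀ x y → x *ᶠ y ≈ᶠ y *ᶠ x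
    *ᶠ-comm _ _ = fraction≈ (*-comm _ _) (*-comm _ _)

    +ᶠ-identityˡ : ∀ x → embed 0# +ᶠ x ≈ᶠ x
    +ᶠ-identityˡ x = fraction≈
      (trans (+-cong (zeroˡ _) (*-identityʳ _)) (+-identityˡ _)) (*-identityˡ _)

    *ᶠ-identityˡ : ∀ x → embed 1# *ᶠ x ≈ᶠ x
    *ᶠ-identityˡ x = fraction≈ (*-identityˡ _) (*-identityˡ _)

    +ᶠ-assoc : ∀ x y z → (x +ᶠ y) +ᶠ z ≈ᶠ x +ᶠ (y +ᶠ z)
    +ᶠ-assoc x y z = fraction≈
      (+-assoc-lemma (num x) (den x) (num y) (den y) (num z) (den z))
      (*-assoc _ _ _)

    distribᶠʳ : ∀ z x y → (x +ᶠ y) *ᶠ z ≈ᶠ (x *ᶠ z) +ᶠ (y *ᶠ z)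
    distribᶠʳ z x y = cross
      (distrib-lemma (num x) (den x) (num y) (den y) (num z) (den z))

  abstract
    fractionIsCommutativeRing : IsCommutativeRing _≈ᶠ_ _+ᶠ_ _*ᶠ_ -ᶠ_ (embed 0#) (embed 1#)
    fractionIsCommutativeRing = record
      { isRing = record
        { +-isAbelianGroup = record
          { isGroup = record
            { isMonoid = record
              { isSemigroup = record
                { isMagma = record
                  { isEquivalence = record
                    { refl  = cross refl
                    ; sym   = ≈ᶠ-sym
                    ; trans = ≈ᶠ-trans
                    }
                  ; ∙-cong = +ᶠ-cong
                  }
                ; assoc = +ᶠ-assoc
                }
              ; identity = +ᶠ-identityˡ , (λ x → ≈ᶠ-trans (+ᶠ-comm x _) (+ᶠ-identityˡ x))
              }
            ; inverse = -ᶠ-inverseˡ , (λ x → ≈ᶠ-trans (+ᶠ-comm x _) (-ᶠ-inverseˡ x))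
            ; ⁻¹-cong = -ᶠ-cong
            }
          ; comm = +ᶠ-comm
          }
        ; *-cong     = *ᶠ-cong
        ; *-assoc    = λ x y z → fraction≈ (*-assoc (num x) (num y) (num z))
                                           (*-assoc (den x) (den y) (den z))
        ; *-identity = *ᶠ-identityˡ , (λ x → ≈ᶠ-trans (*ᶠ-comm x _) (*ᶠ-identityˡ x))
        ; distrib    = (λ z x y → ≈ᶠ-trans (*ᶠ-comm z _) (≈ᶠ-trans (distribᶠʳ z x y)
                                    (+ᶠ-cong (*ᶠ-comm x z) (*ᶠ-comm y z))))
                     , distribᶠʳ
        }
      ; *-comm = *ᶠ-comm
      }

  fractionRing : CommutativeRing (a ⊔ ℓ) ℓ
  fractionRing = record
    { Carrier = Fraction
    ; _≈_     = _≈ᶠ_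
    ; _+_     = _+ᶠ_
    ; _*_     = _*ᶠ_
    ; -_      = -ᶠ_
    ; 0#      = embed 0#
    ; 1#      = embed 1#
    ; isCommutativeRing = fractionIsCommutativeRing
    }

  num≈0 : ∀ {x} → num x ≈ 0# → x ≈ᶠ embed 0#
  num≈0 p = cross (trans (*-identityʳ _) (trans p (sym (zeroˡ _))))

  ≈0⇒num≈0 : ∀ {x} → x ≈ᶠ embed 0# → num x ≈ 0#
  ≈0⇒num≈0 (cross p) = trans (sym (*-identityʳ _)) (trans p (zeroˡ _))

  module _ (_≟_ : ∀ x y → Dec (x ≈ y)) where

    private
      inv : (x : Fraction) → Dec (num x ≈ 0#) → Fraction
      inv x (yes _)  = embed 0#
      inv x (no n≉0) = frac (den x) (num x) n≉0

      inv-cong : ∀ {x y} d e → x ≈ᶠ y → inv x d ≈ᶠ inv y e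
      inv-cong (yes _) (yes _) _ = cross refl
      inv-cong {x} {y} (yes p) (no n) x≈y = ⊥-elim (n (≈0⇒num≈0 (≈ᶠ-trans (≈ᶠ-sym x≈y) (num≈0 p))))
      inv-cong {x} {y} (no n) (yes p) x≈y = ⊥-elim (n (≈0⇒num≈0 (≈ᶠ-trans x≈y (num≈0 p))))
      inv-cong {x} {y} (no _) (no _) (cross p) = cross (begin
        den x * num y   ≈⟨ *-comm _ _ ⟩
        num y * den x   ≈⟨ p ⟨
        num x * den y   ≈⟨ *-comm _ _ ⟩
        den y * num x   ∎)

      inv-inverse : ∀ x d → ¬ (x ≈ᶠ embed 0#) → x *ᶠ inv x d ≈ᶠ embed 1#
      inv-inverse x (yes p) x≉0 = ⊥-elim (x≉0 (num≈0 p))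
      inv-inverse x (no _)  _   = cross (begin
        (num x * den x) * 1#   ≈⟨ *-identityʳ _ ⟩
        num x * den x          ≈⟨ *-comm _ _ ⟩
        den x * num x          ≈⟨ *-identityˡ _ ⟨
        1# * (den x * num x)   ∎)

      inv-0 : ∀ d → inv (embed 0#) d ≈ᶠ embed 0#
      inv-0 (yes _) = cross refl
      inv-0 (no n)  = ⊥-elim (n refl)

    fractionField : DiscreteField (a ⊔ ℓ) ℓ
    DiscreteField.commutativeRing fractionField     = fractionRing
    DiscreteField._≟_             fractionField x y =
      map′ cross cross≈ ((num x * den y) ≟ (num y * den x))
    DiscreteField.1≉0             fractionField p   = 1≉0 (≈0⇒num≈0 p)
    DiscreteField._⁻¹             fractionField x   = inv x (num x ≟ 0#)
    DiscreteField.⁻¹-cong         fractionField {x} {y} = inv-cong (num x ≟ 0#) (num y ≟ 0#)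
    DiscreteField.0⁻¹≈0           fractionField     = inv-0 (0# ≟ 0#)
    DiscreteField.*-inverse       fractionField x   = inv-inverse x (num x ≟ 0#)

-- K(t), the field of rational functions in one indeterminate t over K.
module RationalFunctions (K : DiscreteField a ℓ) where
  open DiscreteField K using (commutativeRing; isIntegralDomain; _≟_)
  open Polynomials commutativeRing public
  open Fractions polynomialRing (polynomialDomain isIntegralDomain _≟_) public

  rationalFunctionField : DiscreteField (a ⊔ ℓ) ℓ
  rationalFunctionField = fractionField (polynomial-≟ isIntegralDomain _≟_)

-- K((t)), presented as the field of fractions of K[[t]].
module LaurentSeries (K : DiscreteField a ℓ) where
  open DiscreteField K using (commutativeRing; isIntegralDomain; _≟_)
  open PowerSeries commutativeRing public
  open Fractions seriesRing (seriesDomain isIntegralDomain _≟_) public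

-- The substitution Z = zʳ, from K(Z) to K((z)).
module Substitution (K : DiscreteField a ℓ) where
  open RationalFunctions K using (coeff; poly≈; num; den; den≉0)
  open LaurentSeries K using (dilate; dilate≉0; frac)

  atZ=z^ : (r : ℕ) .{{_ : NonZero r}} → RationalFunctions.Fraction K → LaurentSeries.Fraction K
  atZ=z^ r f = frac
    (dilate r (coeff (num f))) (dilate r (coeff (den f)))
    (dilate≉0 r (coeff (den f)) (λ d≈0 → den≉0 f (poly≈ d≈0)))

------------------------------------------------------------------------
-- Little q-Jacobi polynomials over a field K, evaluated at an element x
-- of the polynomial ring over K

module LittleQJacobi (K : DiscreteField a ℓ) where
  open DiscreteField K
  open Polynomials commutativeRing
  private module P = CommutativeRing polynomialRing
  open RawSemiringOps (Semiring.rawSemiring P.semiring) using () renaming (_^_ to _^ₚ_; sum to sumₚ)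

  -- (α;q)ₙ
  qPochhammer : Carrier → Carrier → ℕ → Carrier
  qPochhammer α q n = product {n} (λ i → 1# - α * q ^ toℕ i)

  -- pₙ(x;α,β|q); the terms of index k > n, which vanish, are left out.
  littleQJacobi : (q : Carrier) (n : ℕ) (x : Polynomial) (α β : Carrier) → Polynomial
  littleQJacobi q n x α β = sumₚ {suc n} (λ i → term (toℕ i))
    where
    term : ℕ → Polynomial
    term k =
      ((qPochhammer (q ^ℤ (ℤ.- (+ n))) q k * qPochhammer (α * β * q ^ suc n) q k)
        * (qPochhammer (α * q) q k * qPochhammer q q k) ⁻¹)
      • ((q • x) ^ₚ k)

  -- pₙ(q⁻ᶜ(1+(q-1)x); Zq⁻ʳ, 1 | qʳ)
  shiftedLittleQJacobi : (q Z : Carrier) → ℤ → ℕ → ℕ → Polynomial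
  shiftedLittleQJacobi q Z c r n =
    littleQJacobi (q ^ r) n
      ((q ^ℤ (ℤ.- c)) • (1ₚ +ₚ (q - 1#) • X))
      (Z * q ^ℤ (ℤ.- (+ r))) 1#

module Orthogonality (K : DiscreteField a ℓ) where
  open DiscreteField K
  open Polynomials commutativeRing
  private module P = CommutativeRing polynomialRing
  open RawSemiringOps (Semiring.rawSemiring P.semiring) using () renaming (_^_ to _^ₚ_)
  open LeftModuleMorphisms rawLeftModule (TensorUnit.rawLeftModule {R = Ring.rawRing ring})

  δ : ℕ → ℕ → Carrier
  δ n m = if does (n ℕP.≟ m) then 1# else 0#

  record IsMomentFunctional (P : ℕ → Polynomial) (φ : Polynomial → Carrier) : Set (a ⊔ ℓ) where
    field
      isLinear   : IsLeftModuleHomomorphism φ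
      normalised : φ 1ₚ ≈ 1#
      norm       : ℕ → Carrier
      norm≉0     : ∀ n → ¬ (norm n ≈ 0#)
      orthogonal : ∀ n m → φ (P n *ₚ P m) ≈ norm n * δ n m

  moment : (Polynomial → Carrier) → ℕ → Carrier
  moment φ n = φ (X ^ₚ n)

------------------------------------------------------------------------
-- The series L_q(-n,c,r)(z), with coefficients in a field K ∋ q

private
  residue : ∀ c r .{{_ : NonZero r}} → ∃ λ m → r ℕ∣.∣ ℤ.∣ + suc m ℤ.- c ∣
  residue (+ k) (suc r) = k ℕ.+ r , ℕ∣.∣-reflexive (≡.cong ℤ.∣_∣ (≡.sym (begin
    + suc (k ℕ.+ r) ℤ.- + k           ≡⟨ ≡.cong (λ i → + i ℤ.- + k) (≡.sym (ℕP.+-suc k r)) ⟩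
    (+ k ℤ.+ + suc r) ℤ.- + k         ≡⟨ ≡.cong (ℤ._- + k) (ℤP.+-comm (+ k) (+ suc r)) ⟩
    (+ suc r ℤ.+ + k) ℤ.- + k         ≡⟨ ℤP.+-assoc (+ suc r) (+ k) (ℤ.- (+ k)) ⟩
    + suc r ℤ.+ (+ k ℤ.- + k)         ≡⟨ ≡.cong (λ i → + suc r ℤ.+ i) (ℤP.+-inverseʳ (+ k)) ⟩
    + suc r ℤ.+ + 0                   ≡⟨ ℤP.+-identityʳ (+ suc r) ⟩
    + suc r                           ∎)))
    where open ≡-Reasoning
  residue -[1+ k ] (suc r) = r ℕ.* (2 ℕ.+ k) , ℕ∣.divides (2 ℕ.+ k)
    (solve 2 (λ k r → (con 1 :+ r :* (con 2 :+ k)) :+ (con 1 :+ k)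
                      := (con 2 :+ k) :* (con 1 :+ r)) ≡.refl k r)
    where open ℕSolver.+-*-Solver

module LSeries (K : DiscreteField a ℓ) (q : DiscreteField.Carrier K) where
  open DiscreteField K
  open LaurentSeries K

  [_] : ℕ → Carrier
  [ m ] = (1# - q ^ m) * (1# - q) ⁻¹

  -- L_q(-n,c,r)(z), a sum over m ≥ 1.  It depends on c only modulo r, unlike
  -- shiftedLittleQJacobi; the first exponent that occurs is c itself exactly
  -- when 1 ≤ c ≤ r.
  L : ℤ → ℕ → ℕ → Series
  L c r n zero    = 0#
  L c r n (suc m) = if does (r ℕ∣.∣? ℤ.∣ + suc m ℤ.- c ∣) then [ suc m ] ^ n else 0#

  L0≉0 : ∀ c r .{{_ : NonZero r}} → ¬ (L c r 0 ≋ λ _ → 0#)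
  L0≉0 c r L≈0 = 1≉0 (trans (sym (reflexive eq)) (at L≈0 (suc m)))
    where
    m = proj₁ (residue c r)
    eq : L c r 0 (suc m) ≡ 1#
    eq rewrite dec-true (r ℕ∣.∣? ℤ.∣ + suc m ℤ.- c ∣) (proj₂ (residue c r)) = ≡.refl

  -- L_q(-n,c,r)(z) / L_q(0,c,r)(z)
  L/L₀ : (c : ℤ) (r : ℕ) .{{_ : NonZero r}} → ℕ → Fraction
  L/L₀ c r n = frac (L c r n) (L c r 0) (L0≉0 c r)

------------------------------------------------------------------------
-- The fields ℚ(q) and ℚ(q,Z) = ℚ(q)(Z), and the Laurent series in z
-- over ℚ(q)

module ℚ⟨q⟩ = RationalFunctions ℚ-field

ℚ⟨q⟩-field : DiscreteField 0ℓ 0ℓ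
ℚ⟨q⟩-field = ℚ⟨q⟩.rationalFunctionField

q : DiscreteField.Carrier ℚ⟨q⟩-field
q = ℚ⟨q⟩.embed ℚ⟨q⟩.X

module ℚ⟨q,Z⟩ = RationalFunctions ℚ⟨q⟩-field

ℚ⟨q,Z⟩-field : DiscreteField 0ℓ 0ℓ
ℚ⟨q,Z⟩-field = ℚ⟨q,Z⟩.rationalFunctionField

-- q and Z as elements of ℚ(q,Z)
q′ Z : DiscreteField.Carrier ℚ⟨q,Z⟩-field
q′ = ℚ⟨q,Z⟩.embed (ℚ⟨q,Z⟩.const q)
Z  = ℚ⟨q,Z⟩.embed ℚ⟨q,Z⟩.X

module ℚ⟨q,Z⟩[x] = Polynomials (DiscreteField.commutativeRing ℚ⟨q,Z⟩-field)

module ℚ⟨q⟩⟨⟨z⟩⟩ = LaurentSeries ℚ⟨q⟩-field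

open LittleQJacobi ℚ⟨q,Z⟩-field public using (shiftedLittleQJacobi)
open Orthogonality ℚ⟨q,Z⟩-field public using (IsMomentFunctional; moment)
open Substitution ℚ⟨q⟩-field public using (atZ=z^)
open LSeries ℚ⟨q⟩-field q public using (L/L₀)

{-# OPTIONS --safe #-}

-- Put p = qʳ and y = q⁻ᶜ(1 + (q-1)x).  Orthogonality to P₀ = 1 gives
-- φ(Pₙ) = 0 for n ≥ 1, a triangular system for the φ(yᵏ).  Its solution is
-- φ(yᵏ) = (1-Z)/(1-Zpᵏ), because with these values φ(Pₙ) becomes the sum
-- ₂φ₁(p⁻ⁿ, Zpⁿ; Zp; p, p), all of whose partial sums have a product
-- form that vanishes at the last index.  Hence φ(yᵏ) = (1-Z) Σⱼ pʲᵏ Zʲ, and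
-- since (1-q)x = 1 - qᶜy, while (1-q)[c+rj] = 1 - qᶜpʲ, induction on n gives
-- φ(xⁿyᵏ) = (1-Z) Σⱼ [c+rj]ⁿ pʲᵏ Zʲ.  At k = 0 and Z = zʳ the sum is
-- z⁻ᶜ L_q(-n,c,r)(z).

module Submission where

open import Defs
open import Algebra.Bundles using (CommutativeRing; Monoid; Ring; Semiring)
import Algebra.Definitions.RawSemiring as RawSemiringOps
import Algebra.Module.Construct.TensorUnit as TensorUnit
open import Algebra.Module.Morphism.Structures using (module LeftModuleMorphisms)
import Algebra.Properties.CommutativeSemigroup as CommutativeSemigroupProperties
import Algebra.Properties.CommutativeSemiring.Exp as CommutativeSemiringExp
import Algebra.Properties.Group as GroupProperties
import Algebra.Properties.Monoid.Sum as MonoidSum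
import Algebra.Properties.Ring as RingProperties
import Algebra.Properties.Semiring.Exp as SemiringExp
import Algebra.Properties.Semiring.Sum as SemiringSum
import Algebra.Solver.Ring.NaturalCoefficients.Default as NatCoeffSolver
open import Data.Bool.Base using (true; false; if_then_else_)
open import Data.Empty using (⊥-elim)
open import Data.Fin.Base using (Fin; toℕ)
open import Data.Fin.Properties using (toℕ<n; toℕ-inject₁; toℕ-fromℕ)
open import Data.Integer.Base as ℤ using (ℤ; +_; _≤_)
import Data.Integer.Properties as ℤP
open import Data.Nat.Base as ℕ using (ℕ; zero; suc; NonZero; z≤n; s≤s)
import Data.Nat.Divisibility as ℕ∣
import Data.Nat.DivMod as ℕ/
open import Data.Nat.Induction using (<-rec)
import Data.Nat.Properties as ℕP
open import Data.Product.Base using (_,_)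
open import Data.Sum.Base using (inj₁; inj₂)
open import Level using (Level)
open import Relation.Binary.PropositionalEquality as ≡ using (_≡_)
import Relation.Binary.Reasoning.Setoid as SetoidReasoning
open import Relation.Nullary.Decidable using (dec-false)
open import Relation.Nullary.Decidable.Core using (does; no; yes)
open import Relation.Nullary.Negation.Core using (¬_)

-- The product form of the partial sums comes from a balance of parameters: the two upper parameters
-- have product Z, and the values of φ raise the lower one from Z to Zp, which is p times that
-- product. Passing from rational functions to series is the other obstacle, since a rational
-- function in Z is a power series only if its denominator can be divided out. The relation `f ~ g`,
-- numerator equals denominator times g, replaces a map. It respects the ring operations and
-- determines g, and quotients are needed only by 1 - Zpᵏ and by the constant 1 - q, whose inverse
-- series are explicit. It also gives the inequalities behind the linear algebra: pᵏ ≠ 1 and Zpᵏ ≠ 1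
-- are read off from constant terms. The substitution Z = zʳ is dilation of series, which is
-- multiplicative, so expansions survive it. The prefactor 1 - Z is never cancelled by hand:
-- normalisation makes it inverse to the series for n = 0. The factor zᶜ is common to both L-series
-- once 1 ≤ c ≤ r; the bounds are needed because L sees c only modulo r while the polynomials see c
-- itself.

-- Sums, rings and fields.

module _ {a ℓ : Level} (M : Monoid a ℓ) where
  open Monoid M
  open MonoidSum M using (sum; sum-init-last; sum-cong-≗)

  sum-last : ∀ (f : ℕ → Carrier) n →
             sum {suc n} (λ i → f (toℕ i)) ≈ sum {n} (λ i → f (toℕ i)) ∙ f n
  sum-last f n = trans (sum-init-last {n} (λ i → f (toℕ i)))
    (∙-cong (reflexive (sum-cong-≗ {n} (λ i → ≡.cong f (toℕ-inject₁ i))))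
            (reflexive (≡.cong f (toℕ-fromℕ n))))

module RingLemmas {a ℓ : Level} (R : CommutativeRing a ℓ) where
  open CommutativeRing R
  open SetoidReasoning setoid
  open GroupProperties +-group using (x∙y⁻¹≈ε⇒x≈y)
  open NatCoeffSolver commutativeSemiring using (solve; _:=_; _:+_; _:*_)

  x-y+y≈x : ∀ x y → (x - y) + y ≈ x
  x-y+y≈x x y = trans (+-assoc x (- y) y) (trans (+-congˡ (-‿inverseˡ y)) (+-identityʳ x))

  +-cancelʳ : ∀ {x y} z → x + z ≈ y + z → x ≈ y
  +-cancelʳ {x} {y} z eq = GroupProperties.∙-cancelʳ +-group z x y eq

  x+y≈z⇒x≈z-y : ∀ {x y z} → x + y ≈ z → x ≈ z - y
  x+y≈z⇒x≈z-y {x} {y} {z} eq = +-cancelʳ y (trans eq (sym (x-y+y≈x z y)))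

  x≉y⇒x-y≉0 : ∀ {x y} → ¬ (x ≈ y) → ¬ (x - y ≈ 0#)
  x≉y⇒x-y≉0 {x} {y} x≉y x-y≈0 = x≉y (x∙y⁻¹≈ε⇒x≈y x y x-y≈0)

  -- The linear terms are moved to the left so that the right-hand side has no subtraction.
  1-x*1-y : ∀ x y → (1# - x) * (1# - y) + (x + y) ≈ 1# + x * y
  1-x*1-y x y = begin
    u * v + (x + y)
      ≈⟨ +-congˡ (+-cong (trans (*-congˡ v+y≈1) (*-identityʳ x)) (trans (*-congˡ u+x≈1) (*-identityʳ y))) ⟨
    u * v + (x * (v + y) + y * (u + x))
      ≈⟨ solve 4 (λ u v x y → u :* v :+ (x :* (v :+ y) :+ y :* (u :+ x))
                  := (u :+ x) :* (v :+ y) :+ x :* y) refl u v x y ⟩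
    (u + x) * (v + y) + x * y
      ≈⟨ +-congʳ (trans (*-cong u+x≈1 v+y≈1) (*-identityˡ 1#)) ⟩
    1# + x * y ∎
    where
    u = 1# - x
    v = 1# - y
    u+x≈1 = x-y+y≈x 1# x
    v+y≈1 = x-y+y≈x 1# y

  -- The step from n to n+1 in partialSum-*-D below, with t = pⁿ⁺¹.
  qPochhammer-telescope : ∀ a b t →
    (1# - (a * b) * t) * (1# - t) + ((1# - a) * (1# - b)) * t ≈ (1# - a * t) * (1# - b * t)
  qPochhammer-telescope a b t = +-cancelʳ ((a * b) * t + t + (a + b) * t) (begin
    (U + V * t) + ((a * b) * t + t + (a + b) * t)
      ≈⟨ solve 6 (λ U V t ab a b → (U :+ V :* t) :+ (ab :* t :+ t :+ (a :+ b) :* t)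
           := (U :+ (ab :* t :+ t)) :+ (V :+ (a :+ b)) :* t) refl U V t (a * b) a b ⟩
    (U + ((a * b) * t + t)) + (V + (a + b)) * t
      ≈⟨ +-cong (1-x*1-y ((a * b) * t) t) (*-congʳ (1-x*1-y a b)) ⟩
    (1# + ((a * b) * t) * t) + (1# + a * b) * t
      ≈⟨ solve 4 (λ o a b t → (o :+ ((a :* b) :* t) :* t) :+ (o :+ a :* b) :* t
           := (o :+ (a :* t) :* (b :* t)) :+ ((a :* b) :* t :+ o :* t)) refl 1# a b t ⟩
    (1# + (a * t) * (b * t)) + ((a * b) * t + 1# * t)
      ≈⟨ +-cong (sym (1-x*1-y (a * t) (b * t))) (+-congˡ (*-identityˡ t)) ⟩
    ((1# - a * t) * (1# - b * t) + (a * t + b * t)) + ((a * b) * t + t)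
      ≈⟨ solve 5 (λ W a b t ab → (W :+ (a :* t :+ b :* t)) :+ (ab :* t :+ t)
           := W :+ (ab :* t :+ t :+ (a :+ b) :* t)) refl _ a b t (a * b) ⟩
    (1# - a * t) * (1# - b * t) + ((a * b) * t + t + (a + b) * t) ∎)
    where
    U = (1# - (a * b) * t) * (1# - t)
    V = (1# - a) * (1# - b)

module FieldLemmas {a ℓ : Level} (F : DiscreteField a ℓ) where
  open DiscreteField F
  open Fractions commutativeRing isIntegralDomain public using (*≉0; *-cancelʳ)
  open RingLemmas commutativeRing using (+-cancelʳ)
  open SemiringSum semiring using (sum-cong-≋)
  open SetoidReasoning setoid

  ⁻¹-inverseˡ : ∀ {x} → ¬ (x ≈ 0#) → x ⁻¹ * x ≈ 1#
  ⁻¹-inverseˡ {x} x≉0 = trans (*-comm (x ⁻¹) x) (*-inverse x x≉0)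

  ⁻¹≉0 : ∀ {x} → ¬ (x ≈ 0#) → ¬ (x ⁻¹ ≈ 0#)
  ⁻¹≉0 {x} x≉0 x⁻¹≈0 = 1≉0 (begin
    1#         ≈⟨ *-inverse x x≉0 ⟨
    x * x ⁻¹   ≈⟨ *-congˡ x⁻¹≈0 ⟩
    x * 0#     ≈⟨ zeroʳ x ⟩
    0#         ∎)

  1⁻¹≈1 : 1# ⁻¹ ≈ 1#
  1⁻¹≈1 = trans (sym (*-identityˡ (1# ⁻¹))) (*-inverse 1# 1≉0)

  ^≉0 : ∀ {x} → ¬ (x ≈ 0#) → ∀ n → ¬ (x ^ n ≈ 0#)
  ^≉0 x≉0 zero    = 1≉0
  ^≉0 x≉0 (suc n) = *≉0 x≉0 (^≉0 x≉0 n)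

  ^ℤ-neg-inverseˡ : ∀ {x} → ¬ (x ≈ 0#) → ∀ n → x ^ℤ (ℤ.- (+ n)) * x ^ n ≈ 1#
  ^ℤ-neg-inverseˡ x≉0 zero    = *-identityˡ 1#
  ^ℤ-neg-inverseˡ x≉0 (suc n) = ⁻¹-inverseˡ (^≉0 x≉0 (suc n))

  -- Forward substitution: the terms below n agree and cancel, and the diagonal entry can be divided
  -- out.
  triangular-unique : ∀ (c x y : ℕ → Carrier) n → ¬ (c n ≈ 0#) → (∀ {k} → k ℕ.< n → x k ≈ y k) →
    sum {suc n} (λ i → c (toℕ i) * x (toℕ i)) ≈ sum {suc n} (λ i → c (toℕ i) * y (toℕ i)) → x n ≈ y n
  triangular-unique c x y n cₙ≉0 x≈y eq =
    *-cancelʳ (c n) cₙ≉0 (trans (*-comm _ _) (trans last≈ (*-comm _ _)))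
    where
    split : ∀ z → sum {suc n} (λ i → c (toℕ i) * z (toℕ i))
                ≈ c n * z n + sum {n} (λ i → c (toℕ i) * z (toℕ i))
    split z = trans (sum-last +-monoid (λ k → c k * z k) n) (+-comm _ _)
    last≈ : c n * x n ≈ c n * y n
    last≈ = +-cancelʳ _ (trans (sym (split x)) (trans eq (trans (split y)
      (+-congˡ (sum-cong-≋ {n} (λ i → *-congˡ (sym (x≈y (toℕ<n i)))))))))

-- q-Pochhammer symbols.

module QPochhammer {a ℓ : Level} (F : DiscreteField a ℓ) where
  open DiscreteField F
  open LittleQJacobi F using (qPochhammer) public
  open FieldLemmas F
  open RingLemmas commutativeRing
  open MonoidSum *-monoid using (sum-cong-≋)

  1-cong : ∀ {x y} → x ≈ y → 1# - x ≈ 1# - y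
  1-cong x≈y = +-congˡ (-‿cong x≈y)

  qPochhammer-last : ∀ α p n → qPochhammer α p (suc n) ≈ qPochhammer α p n * (1# - α * p ^ n)
  qPochhammer-last α p n = sum-last *-monoid (λ i → 1# - α * p ^ i) n

  qPochhammer-first : ∀ α p n → qPochhammer α p (suc n) ≈ (1# - α) * qPochhammer (α * p) p n
  qPochhammer-first α p n = *-cong (1-cong (*-identityʳ α))
    (sum-cong-≋ {n} (λ i → 1-cong (sym (*-assoc α p (p ^ toℕ i)))))

  qPochhammer≉0 : ∀ α p n → (∀ {i} → i ℕ.< n → ¬ (α * p ^ i ≈ 1#)) → ¬ (qPochhammer α p n ≈ 0#)
  qPochhammer≉0 α p zero    _    = 1≉0
  qPochhammer≉0 α p (suc n) αp≉1 eq =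
    *≉0 (qPochhammer≉0 α p n (λ i<n → αp≉1 (ℕP.m<n⇒m<1+n i<n)))
        (x≉y⇒x-y≉0 (λ eq′ → αp≉1 (ℕP.n<1+n n) (sym eq′)))
        (trans (sym (qPochhammer-last α p n)) eq)

  qPochhammer-terminates : ∀ α p n → α * p ^ n ≈ 1# → qPochhammer α p (suc n) ≈ 0#
  qPochhammer-terminates α p n αpⁿ≈1 = trans (qPochhammer-last α p n)
    (trans (*-congˡ (trans (1-cong αpⁿ≈1) (-‿inverseʳ 1#))) (zeroʳ _))

-- Scalar multiples of polynomials and linear functionals.

module PolynomialLemmas {a ℓ : Level} (R : CommutativeRing a ℓ) where
  open CommutativeRing R
  open Polynomials R
  open PowerSeries R using (coeffwise; at)
  open SemiringSum semiring using (sum-cong-≋; *-distribˡ-sum)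
  module P = CommutativeRing polynomialRing
  open RawSemiringOps (Semiring.rawSemiring P.semiring) public using () renaming (_^_ to _^ₚ_; sum to sumₚ)

  •-cong : ∀ {x y f g} → x ≈ y → f ≈ₚ g → x • f ≈ₚ y • g
  •-cong x≈y f≈g = poly≈ (coeffwise (λ n → *-cong x≈y (at (series≈ f≈g) n)))

  •-assoc : ∀ x y f → x • (y • f) ≈ₚ (x * y) • f
  •-assoc x y f = poly≈ (coeffwise (λ n → sym (*-assoc x y (coeff f n))))

  •-identity : ∀ f → 1# • f ≈ₚ f
  •-identity f = poly≈ (coeffwise (λ n → *-identityˡ (coeff f n)))

  •-*ₚ-assoc : ∀ x f g → (x • f) *ₚ g ≈ₚ x • (f *ₚ g)
  •-*ₚ-assoc x f g = poly≈ (coeffwise (λ n → trans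
    (sum-cong-≋ {suc n} (λ i → *-assoc x (coeff f (toℕ i)) (coeff g (n ℕ.∸ toℕ i))))
    (sym (*-distribˡ-sum x (λ i → coeff f (toℕ {suc n} i) * coeff g (n ℕ.∸ toℕ i))))))

  *ₚ-•-comm : ∀ x f g → f *ₚ (x • g) ≈ₚ x • (f *ₚ g)
  *ₚ-•-comm x f g = P.trans (P.*-comm f (x • g))
    (P.trans (•-*ₚ-assoc x g f) (•-cong refl (P.*-comm g f)))

  open RawSemiringOps (Semiring.rawSemiring semiring) using (_^_)

  •-^ : ∀ x f n → (x • f) ^ₚ n ≈ₚ (x ^ n) • (f ^ₚ n)
  •-^ x f zero    = P.sym (•-identity 1ₚ)
  •-^ x f (suc n) = P.trans (•-*ₚ-assoc x f _) (P.trans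
    (•-cong refl (P.trans (P.*-congˡ (•-^ x f n)) (*ₚ-•-comm (x ^ n) f (f ^ₚ n))))
    (•-assoc x (x ^ n) (f *ₚ f ^ₚ n)))

  module Linear {φ : Polynomial → Carrier}
    (isLinear : LeftModuleMorphisms.IsLeftModuleHomomorphism rawLeftModule
                  (TensorUnit.rawLeftModule {R = Ring.rawRing ring}) φ) where
    open LeftModuleMorphisms.IsLeftModuleHomomorphism isLinear public using ()
      renaming (⟦⟧-cong to φ-cong; +ᴹ-homo to φ-+; *ₗ-homo to φ-•; 0ᴹ-homo to φ-0)
    open RawSemiringOps (Semiring.rawSemiring semiring) using (sum)

    φ-sum : ∀ {n} (t : Fin n → Polynomial) → φ (sumₚ t) ≈ sum (λ i → φ (t i))
    φ-sum {zero}  t = φ-0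
    φ-sum {suc n} t = trans (φ-+ _ _) (+-congˡ (φ-sum {n} (λ i → t (Fin.suc i))))

-- Moments of the little q-Jacobi polynomials with second parameter 1.

module LittleQJacobiMoments {ℓ₁ ℓ₂ : Level} (F : DiscreteField ℓ₁ ℓ₂) where
  open DiscreteField F

  module Generic (p α : Carrier)
    (p≉0 : ¬ (p ≈ 0#))
    (pᵏ≉1 : ∀ k → ¬ (p ^ suc k ≈ 1#))
    (αpᵏ≉1 : ∀ k → ¬ ((α * p) * p ^ k ≈ 1#))
    where
    open FieldLemmas F
    open RingLemmas commutativeRing
    open QPochhammer F
    open SemiringExp semiring using (^-homo-*)
    open SemiringSum semiring using (sum-cong-≋)
    open SetoidReasoning setoid
    open NatCoeffSolver commutativeSemiring using (solve; _:=_; _:+_; _:*_)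

    -- The quotient (αp;p)ₖ/(αp²;p)ₖ after cancellation. It is the value that φ will turn out to
    -- take on the k-th power of the argument.
    ν : ℕ → Carrier
    ν k = (1# - α * p) * (1# - (α * p) * p ^ k) ⁻¹

    coefficient : (a b : Carrier) → ℕ → Carrier
    coefficient a b k =
      (qPochhammer a p k * qPochhammer b p k) * (qPochhammer (α * p) p k * qPochhammer p p k) ⁻¹

    1-αpᵏ≉0 : ∀ k → ¬ (1# - (α * p) * p ^ k ≈ 0#)
    1-αpᵏ≉0 k = x≉y⇒x-y≉0 (λ eq → αpᵏ≉1 k (sym eq))

    pPochhammer≉0 : ∀ k → ¬ (qPochhammer p p k ≈ 0#)
    pPochhammer≉0 k = qPochhammer≉0 p p k (λ {i} _ → pᵏ≉1 i)

    coefficient-denominator≉0 : ∀ k → ¬ (qPochhammer (α * p) p k * qPochhammer p p k ≈ 0#)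
    coefficient-denominator≉0 k =
      *≉0 (qPochhammer≉0 (α * p) p k (λ {i} _ → αpᵏ≉1 i)) (pPochhammer≉0 k)

    -- (1-αp)/(1-αpᵏ⁺¹) turns the factor (αp;p)ₖ of the denominator of a coefficient into (αp²;p)ₖ.
    D : ℕ → Carrier
    D k = qPochhammer ((α * p) * p) p k * qPochhammer p p k

    D≉0 : ∀ k → ¬ (D k ≈ 0#)
    D≉0 k = *≉0 (qPochhammer≉0 _ p k (λ {i} _ eq → αpᵏ≉1 (suc i) (trans (sym (*-assoc _ _ _)) eq)))
                (pPochhammer≉0 k)

    summand : (a b : Carrier) → ℕ → Carrier
    summand a b k = coefficient a b k * (p ^ k * ν k)

    -- Splitting off the first or the last factor of (αp;p)ₖ₊₁ gives (1-αp)(αp²;p)ₖ =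
    -- (αp;p)ₖ(1-αpᵏ⁺¹), so `D k` clears the denominators of the coefficient and of `ν k` together.
    summand-*-D : ∀ a b k →
      summand a b k * D k ≈ (qPochhammer a p k * qPochhammer b p k) * p ^ k
    summand-*-D a b k = begin
      ((A * E⁻¹) * (p ^ k * ((1# - α * p) * w))) * (qPochhammer ((α * p) * p) p k * P)
        ≈⟨ solve 7 (λ A e t s w B P → ((A :* e) :* (t :* (s :* w))) :* (B :* P)
                    := (A :* t) :* ((e :* ((s :* B) :* P)) :* w)) refl A E⁻¹ (p ^ k) (1# - α * p) w _ P ⟩
      (A * p ^ k) * ((E⁻¹ * (((1# - α * p) * qPochhammer ((α * p) * p) p k) * P)) * w)
        ≈⟨ *-congˡ (*-congʳ (*-congˡ (*-congʳ
             (trans (sym (qPochhammer-first (α * p) p k)) (qPochhammer-last (α * p) p k))))) ⟩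
      (A * p ^ k) * ((E⁻¹ * ((Zₖ * u) * P)) * w)
        ≈⟨ solve 6 (λ A e Z u P w → A :* ((e :* ((Z :* u) :* P)) :* w)
                    := A :* ((e :* (Z :* P)) :* (u :* w))) refl (A * p ^ k) E⁻¹ Zₖ u P w ⟩
      (A * p ^ k) * ((E⁻¹ * (Zₖ * P)) * (u * w))
        ≈⟨ *-congˡ (trans (*-cong (⁻¹-inverseˡ (coefficient-denominator≉0 k))
                                  (*-inverse u (1-αpᵏ≉0 k))) (*-identityˡ 1#)) ⟩
      (A * p ^ k) * 1#
        ≈⟨ *-identityʳ _ ⟩
      A * p ^ k ∎
      where
      A   = qPochhammer a p k * qPochhammer b p k
      Zₖ  = qPochhammer (α * p) p k
      P   = qPochhammer p p k
      E⁻¹ = (Zₖ * P) ⁻¹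
      u   = 1# - (α * p) * p ^ k
      w   = u ⁻¹

    partialSum : (a b : Carrier) → ℕ → Carrier
    partialSum a b n = sum {suc n} (λ i → summand a b (toℕ i))

    -- Induction on n. By the balance ab = αp the new factor 1 - αp²pⁿ of `D` is 1 - abt with t =
    -- pⁿ⁺¹, and then the old sum and the new term combine into one product.
    partialSum-*-D : ∀ a b → a * b ≈ α * p → ∀ n →
      partialSum a b n * D n ≈ qPochhammer (a * p) p n * qPochhammer (b * p) p n
    partialSum-*-D a b ab≈αp zero = trans (*-congʳ (+-identityʳ _)) (trans (summand-*-D a b 0) (*-identityʳ _))
    partialSum-*-D a b ab≈αp (suc n) = begin
      partialSum a b (suc n) * D (suc n)
        ≈⟨ *-congʳ (sum-last +-monoid (summand a b) (suc n)) ⟩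
      (partialSum a b n + summand a b (suc n)) * D (suc n)
        ≈⟨ distribʳ _ _ _ ⟩
      partialSum a b n * D (suc n) + summand a b (suc n) * D (suc n)
        ≈⟨ +-cong (*-congˡ (*-cong (qPochhammer-last _ p n) (qPochhammer-last p p n)))
                  (trans (summand-*-D a b (suc n))
                         (*-congʳ (*-cong (qPochhammer-first a p n) (qPochhammer-first b p n)))) ⟩
      partialSum a b n * ((B * d) * (P * e)) + (((1# - a) * A₁) * ((1# - b) * A₂)) * t
        ≈⟨ +-cong (solve 5 (λ s B d P e → s :* ((B :* d) :* (P :* e)) := (s :* (B :* P)) :* (d :* e))
                     refl (partialSum a b n) B d P e)
                  (solve 5 (λ x A y A′ t → ((x :* A) :* (y :* A′)) :* t := (A :* A′) :* ((x :* y) :* t))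
                     refl (1# - a) A₁ (1# - b) A₂ t) ⟩
      (partialSum a b n * D n) * (d * e) + (A₁ * A₂) * (((1# - a) * (1# - b)) * t)
        ≈⟨ +-congʳ (*-cong (partialSum-*-D a b ab≈αp n)
             (*-congʳ (1-cong (trans (*-assoc _ p (p ^ n)) (*-congʳ (sym ab≈αp)))))) ⟩
      (A₁ * A₂) * ((1# - (a * b) * t) * e) + (A₁ * A₂) * (((1# - a) * (1# - b)) * t)
        ≈⟨ distribˡ _ _ _ ⟨
      (A₁ * A₂) * ((1# - (a * b) * t) * e + ((1# - a) * (1# - b)) * t)
        ≈⟨ *-congˡ (qPochhammer-telescope a b t) ⟩
      (A₁ * A₂) * ((1# - a * t) * (1# - b * t))
        ≈⟨ *-congˡ (*-cong (1-cong (*-assoc a p _)) (1-cong (*-assoc b p _))) ⟨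
      (A₁ * A₂) * ((1# - (a * p) * p ^ n) * (1# - (b * p) * p ^ n))
        ≈⟨ solve 4 (λ A A′ x y → (A :* A′) :* (x :* y) := (A :* x) :* (A′ :* y)) refl A₁ A₂ _ _ ⟩
      (A₁ * (1# - (a * p) * p ^ n)) * (A₂ * (1# - (b * p) * p ^ n))
        ≈⟨ *-cong (qPochhammer-last (a * p) p n) (qPochhammer-last (b * p) p n) ⟨
      qPochhammer (a * p) p (suc n) * qPochhammer (b * p) p (suc n) ∎
      where
      A₁ = qPochhammer (a * p) p n
      A₂ = qPochhammer (b * p) p n
      B  = qPochhammer ((α * p) * p) p n
      P  = qPochhammer p p n
      t  = p ^ suc n
      d  = 1# - ((α * p) * p) * p ^ n
      e  = 1# - p * p ^ n

    -- The last factor of (ap;p)ₙ₊₁ is 1 - apⁿ⁺¹ = 0. The index is a successor because at 0 this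
    -- product is empty and the sum is 1.
    sum≈0 : ∀ a b n → a * b ≈ α * p → a * p ^ suc n ≈ 1# → partialSum a b (suc n) ≈ 0#
    sum≈0 a b n ab≈αp apⁿ≈1 = IsIntegralDomain.noZeroDivisors isIntegralDomain _ (D (suc n))
      (trans (partialSum-*-D a b ab≈αp (suc n))
        (trans (*-congʳ (qPochhammer-terminates (a * p) p n (trans (*-assoc a p (p ^ n)) apⁿ≈1))) (zeroˡ _)))
      (D≉0 (suc n))

    -- The factor `1#` is the parameter β of `littleQJacobi`. With it, `coefficient (a n) (b n)` is
    -- the coefficient used there by definition.
    a b : ℕ → Carrier
    a n = p ^ℤ (ℤ.- (+ n))
    b n = α * 1# * p ^ suc n

    ab≈αp : ∀ n → a n * b n ≈ α * p
    ab≈αp n = begin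
      a n * (α * 1# * (p * p ^ n))
        ≈⟨ *-congˡ (*-congʳ (*-identityʳ α)) ⟩
      a n * (α * (p * p ^ n))
        ≈⟨ solve 4 (λ a α p t → a :* (α :* (p :* t)) := (α :* p) :* (a :* t)) refl (a n) α p (p ^ n) ⟩
      (α * p) * (a n * p ^ n)
        ≈⟨ *-congˡ (^ℤ-neg-inverseˡ p≉0 n) ⟩
      (α * p) * 1#
        ≈⟨ *-identityʳ _ ⟩
      α * p ∎

    -- Multiplying p⁻ⁿpⁱ = 1 by pⁿ⁻ⁱ would give pⁿ⁻ⁱ = 1 with a positive exponent.
    apⁱ≉1 : ∀ n {i} → i ℕ.< n → ¬ (a n * p ^ i ≈ 1#)
    apⁱ≉1 n {i} i<n apⁱ≈1 with k , ≡.refl ← ℕP.m≤n⇒∃[o]m+o≡n i<n = pᵏ≉1 k (begin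
      p ^ suc k                       ≈⟨ *-identityˡ _ ⟨
      1# * p ^ suc k                  ≈⟨ *-congʳ apⁱ≈1 ⟨
      (a n * p ^ i) * p ^ suc k       ≈⟨ *-assoc _ _ _ ⟩
      a n * (p ^ i * p ^ suc k)       ≈⟨ *-congˡ (^-homo-* p i (suc k)) ⟨
      a n * p ^ (i ℕ.+ suc k)         ≡⟨ ≡.cong (λ m → a n * p ^ m) (ℕP.+-suc i k) ⟩
      a n * p ^ n                     ≈⟨ ^ℤ-neg-inverseˡ p≉0 n ⟩
      1#                              ∎)

    bpⁱ≉1 : ∀ n i → ¬ (b n * p ^ i ≈ 1#)
    bpⁱ≉1 n i bpⁱ≈1 = αpᵏ≉1 (n ℕ.+ i) (begin
      (α * p) * p ^ (n ℕ.+ i)     ≈⟨ *-congˡ (^-homo-* p n i) ⟩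
      (α * p) * (p ^ n * p ^ i)   ≈⟨ solve 4 (λ α p s t → (α :* p) :* (s :* t) := (α :* (p :* s)) :* t)
                                       refl α p (p ^ n) (p ^ i) ⟩
      (α * p ^ suc n) * p ^ i     ≈⟨ *-congʳ (*-congʳ (*-identityʳ α)) ⟨
      b n * p ^ i                 ≈⟨ bpⁱ≈1 ⟩
      1#                          ∎)

    leadingCoefficient≉0 : ∀ n → ¬ (coefficient (a n) (b n) n ≈ 0#)
    leadingCoefficient≉0 n = *≉0
      (*≉0 (qPochhammer≉0 (a n) p n (apⁱ≉1 n)) (qPochhammer≉0 (b n) p n (λ {i} _ → bpⁱ≉1 n i)))
      (⁻¹≉0 (coefficient-denominator≉0 n))

    open Polynomials commutativeRing using (Polynomial; 1ₚ; _•_; _*ₚ_; _≈ₚ_)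
    open PolynomialLemmas commutativeRing
    open LittleQJacobi F using (littleQJacobi)
    module O = Orthogonality F

    module _ (x : Polynomial) {φ : Polynomial → Carrier}
      (isMoment : O.IsMomentFunctional (λ n → littleQJacobi p n x α 1#) φ) where
      open O.IsMomentFunctional isMoment
      open Linear isLinear

      P₀≈1 : littleQJacobi p 0 x α 1# ≈ₚ 1ₚ
      P₀≈1 = P.trans (P.+-identityʳ _) (P.trans
        (•-cong (trans (*-cong (*-identityˡ 1#) (trans (⁻¹-cong (*-identityˡ 1#)) 1⁻¹≈1)) (*-identityˡ 1#)) P.refl)
        (•-identity 1ₚ))

      φ-P≈0 : ∀ n → φ (littleQJacobi p (suc n) x α 1#) ≈ 0#
      φ-P≈0 n = begin
        φ Pₙ                             ≈⟨ φ-cong (P.*-identityʳ Pₙ) ⟨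
        φ (Pₙ *ₚ 1ₚ)                     ≈⟨ φ-cong (P.*-congˡ {Pₙ} P₀≈1) ⟨
        φ (Pₙ *ₚ littleQJacobi p 0 x α 1#)   ≈⟨ orthogonal (suc n) 0 ⟩
        norm (suc n) * 0#                ≈⟨ zeroʳ _ ⟩
        0#                               ∎
        where
        Pₙ = littleQJacobi p (suc n) x α 1#

      φ-P : ∀ n → φ (littleQJacobi p n x α 1#)
                ≈ sum {suc n} (λ i → coefficient (a n) (b n) (toℕ i) * (p ^ toℕ i * φ (x ^ₚ toℕ i)))
      φ-P n = trans (φ-sum {suc n} (λ i → c (toℕ i) • (p • x) ^ₚ toℕ i)) (sum-cong-≋ {suc n} (λ i →
        trans (φ-• (c (toℕ i)) _)
              (*-congˡ (trans (φ-cong (•-^ p x (toℕ i))) (φ-• (p ^ toℕ i) (x ^ₚ toℕ i))))))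
        where
        c = coefficient (a n) (b n)

      φ-^ : ∀ k → φ (x ^ₚ k) ≈ ν k
      φ-^ = <-rec (λ k → φ (x ^ₚ k) ≈ ν k) step
        where
        step : ∀ n → (∀ {k} → k ℕ.< n → φ (x ^ₚ k) ≈ ν k) → φ (x ^ₚ n) ≈ ν n
        step zero    _ = trans normalised (sym (trans
          (*-congˡ (⁻¹-cong (1-cong (*-identityʳ _))))
          (*-inverse _ (λ eq → 1-αpᵏ≉0 0 (trans (1-cong (*-identityʳ _)) eq)))))
        -- The polynomials are sums of powers of p • x, so the unknowns of the triangular system are
        -- pᵏφ(xᵏ); the power of p is cancelled at the end.
        step (suc n) φ≈ν = *-cancelʳ (p ^ suc n) (^≉0 p≉0 (suc n))
          (trans (*-comm _ _) (trans
            (triangular-unique (coefficient (a (suc n)) (b (suc n)))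
              (λ k → p ^ k * φ (x ^ₚ k)) (λ k → p ^ k * ν k) (suc n)
              (leadingCoefficient≉0 (suc n)) (λ k<n → *-congˡ (φ≈ν k<n))
              (trans (sym (φ-P (suc n))) (trans (φ-P≈0 n)
                (sym (sum≈0 _ _ n (ab≈αp (suc n)) (^ℤ-neg-inverseˡ p≉0 (suc n)))))))
            (*-comm _ _)))

      -- The division-free form from which `~-quotient` reads off a series.
      φ-^-*-1-αpᵏ : ∀ k → φ (x ^ₚ k) * (1# - (α * p) * p ^ k) ≈ 1# - α * p
      φ-^-*-1-αpᵏ k = trans (*-congʳ (φ-^ k)) (trans (*-assoc _ _ _)
        (trans (*-congˡ (⁻¹-inverseˡ (1-αpᵏ≉0 k))) (*-identityʳ _)))

-- Shift and dilation of power series.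

module SeriesLemmas {a ℓ : Level} (R : CommutativeRing a ℓ) where
  open CommutativeRing R
  open PowerSeries R
  open SetoidReasoning setoid
  module S = CommutativeRing seriesRing

  tail : Series → Series
  tail f n = f (suc n)

  shift : ℕ → Series → Series
  shift zero    f n       = f n
  shift (suc c) f zero    = 0#
  shift (suc c) f (suc n) = shift c f n

  shift-< : ∀ c f {n} → n ℕ.< c → shift c f n ≡ 0#
  shift-< (suc c) f {zero}  _         = ≡.refl
  shift-< (suc c) f {suc n} (s≤s n<c) = shift-< c f n<c

  shift-+ : ∀ c f n → shift c f (c ℕ.+ n) ≡ f n
  shift-+ zero    f n = ≡.refl
  shift-+ (suc c) f n = shift-+ c f n

  shift-cong : ∀ c {f g} → f ≋ g → shift c f ≋ shift c g
  shift-cong c {f} {g} f≋g = coeffwise (go c)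
    where
    go : ∀ c n → shift c f n ≈ shift c g n
    go zero    n       = at f≋g n
    go (suc c) zero    = refl
    go (suc c) (suc n) = go c n

  shift-* : ∀ c f g → convolution (shift c f) g ≋ shift c (convolution f g)
  shift-* c f g = coeffwise (go c)
    where
    go : ∀ c n → convolution (shift c f) g n ≈ shift c (convolution f g) n
    go zero    n       = refl
    go (suc c) zero    = trans (+-identityʳ _) (zeroˡ _)
    go (suc c) (suc n) = trans (+-congʳ (zeroˡ _)) (trans (+-identityˡ _) (go c n))

  *-drop : ∀ k f g n → (∀ {i} → i ℕ.< k → f i ≈ 0#) →
           convolution f g (k ℕ.+ n) ≈ convolution (λ i → f (k ℕ.+ i)) g n
  *-drop zero    f g n _   = refl
  *-drop (suc k) f g n f≈0 = trans
    (+-cong (trans (*-congʳ (f≈0 (s≤s z≤n))) (zeroˡ _))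
            (*-drop k (tail f) g n (λ i<k → f≈0 (s≤s i<k))))
    (+-identityˡ _)

  module _ (r : ℕ) .{{_ : NonZero r}} where

    dilate-∤ : ∀ f {n} → ¬ (r ℕ∣.∣ n) → dilate r f n ≡ 0#
    dilate-∤ f {n} r∤n rewrite dec-false (r ℕ∣.∣? n) r∤n = ≡.refl

    dilate-0 : ∀ f → dilate r f 0 ≡ f 0
    dilate-0 f = dilate-* r f 0

    dilate-+ : ∀ f n → dilate r f (r ℕ.+ n) ≡ dilate r (tail f) n
    dilate-+ f n with r ℕ∣.∣? n
    ... | yes (ℕ∣.divides m ≡.refl) =
      ≡.trans (dilate-* r f (suc m)) (≡.cong (tail f) (≡.sym (ℕ/.m*n/n≡m m r)))
    ... | no r∤n = dilate-∤ f (λ r∣r+n → r∤n (ℕ∣.∣m+n∣m⇒∣n r∣r+n ℕ∣.∣-refl))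

    dilate-< : ∀ f {i} → suc i ℕ.< r → dilate r f (suc i) ≡ 0#
    dilate-< f i<r = dilate-∤ f (ℕ∣.>⇒∤ i<r)

    dilate-cong : ∀ {f g} → f ≋ g → dilate r f ≋ dilate r g
    dilate-cong {f} {g} f≋g = coeffwise go
      where
      go : ∀ n → dilate r f n ≈ dilate r g n
      go n with does (r ℕ∣.∣? n)
      ... | true  = at f≋g (n ℕ./ r)
      ... | false = refl

    dilate-one : dilate r one ≋ one
    dilate-one = coeffwise go
      where
      go : ∀ n → dilate r one n ≈ one n
      go zero    = reflexive (dilate-0 one)
      go (suc n) with r ℕ∣.∣? suc n
      ... | no _ = refl
      ... | yes (ℕ∣.divides (suc m) eq) = reflexive
        (≡.trans (≡.cong (λ i → one (i ℕ./ r)) eq) (≡.cong one (ℕ/.m*n/n≡m (suc m) r)))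

    dilate-linear : ∀ x f g n → dilate r (λ i → x * f i + g i) n ≈ x * dilate r f n + dilate r g n
    dilate-linear x f g n with does (r ℕ∣.∣? n)
    ... | true  = refl
    ... | false = sym (trans (+-identityʳ _) (zeroʳ x))

    private
      -- Each way of splitting n+1 has a part strictly between 0 and r. The term with left exponent
      -- 0 vanishes through g, all others through f; `*-drop` is used at n + 0 to reach the last of
      -- them.
      dilate-*-< : ∀ f g n → suc n ℕ.< r → convolution (dilate r f) (dilate r g) (suc n) ≈ 0#
      dilate-*-< f g n n<r = trans
        (+-cong (trans (*-congˡ (reflexive (dilate-< g n<r))) (zeroʳ _))
          (trans (reflexive (≡.cong (convolution (tail (dilate r f)) (dilate r g)) (≡.sym (ℕP.+-identityʳ n))))
            (trans (*-drop n (tail (dilate r f)) (dilate r g) 0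
                     (λ i<n → reflexive (dilate-< f (ℕP.<-trans (s≤s i<n) n<r))))
              (trans (+-identityʳ _) (trans
                (*-congʳ (reflexive (dilate-< f (≡.subst (λ m → suc m ℕ.< r) (≡.sym (ℕP.+-identityʳ n)) n<r))))
                (zeroˡ _))))))
        (+-identityˡ 0#)

    -- A dilated series has no terms strictly between the exponents 0 and r, so removing the
    -- constant term of f lowers the degree by r.
    *-dilate-+ : ∀ f g n → convolution (dilate r f) g (r ℕ.+ n)
                         ≈ f 0 * g (r ℕ.+ n) + convolution (dilate r (tail f)) g n
    *-dilate-+ f g n = go r ≡.refl
      where
      -- The convolution unfolds only at a successor; a copy k of the fixed r is matched on.
      go : ∀ k → r ≡ k → convolution (dilate r f) g (k ℕ.+ n)
                       ≈ f 0 * g (k ℕ.+ n) + convolution (dilate r (tail f)) g n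
      go zero    eq = ⊥-elim (ℕ.≢-nonZero⁻¹ r eq)
      go (suc k) eq = +-cong (*-congʳ (reflexive (dilate-0 f))) (trans
        (*-drop k (tail (dilate r f)) g n
          (λ i<k → reflexive (dilate-< f (≡.subst (_ ℕ.<_) (≡.sym eq) (s≤s i<k)))))
        (at (S.*-congʳ {g} (coeffwise (λ i → reflexive
          (≡.trans (≡.cong (λ k → dilate r f (k ℕ.+ i)) (≡.sym eq)) (dilate-+ f i))))) n))

    -- Strong induction on the exponent, in steps of r, by `*-dilate-+`. The induction hypothesis is
    -- applied to `tail f`, so `Goal` quantifies over f.
    dilate-homo-* : ∀ f g → convolution (dilate r f) (dilate r g) ≋ dilate r (convolution f g)
    dilate-homo-* f g = coeffwise (λ n → <-rec Goal step n f)
      where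
      Goal : ℕ → Set _
      Goal n = ∀ f → convolution (dilate r f) (dilate r g) n ≈ dilate r (convolution f g) n

      high : ∀ n → (∀ {m} → m ℕ.< r ℕ.+ n → Goal m) → Goal (r ℕ.+ n)
      high n ih f = begin
        convolution (dilate r f) (dilate r g) (r ℕ.+ n)
          ≈⟨ *-dilate-+ f (dilate r g) n ⟩
        f 0 * dilate r g (r ℕ.+ n) + convolution (dilate r (tail f)) (dilate r g) n
          ≈⟨ +-cong (*-congˡ (reflexive (dilate-+ g n)))
                    (ih (ℕP.m<n+m n (ℕ.>-nonZero⁻¹ r)) (tail f)) ⟩
        f 0 * dilate r (tail g) n + dilate r (convolution (tail f) g) n
          ≈⟨ dilate-linear (f 0) (tail g) (convolution (tail f) g) n ⟨
        dilate r (tail (convolution f g)) n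
          ≡⟨ dilate-+ (convolution f g) n ⟨
        dilate r (convolution f g) (r ℕ.+ n) ∎

      step : ∀ n → (∀ {m} → m ℕ.< n → Goal m) → Goal n
      step n ih f with ℕP.<-≤-connex n r
      step zero    ih f | inj₁ _ = begin
        dilate r f 0 * dilate r g 0 + 0#
          ≈⟨ +-congʳ (*-cong (reflexive (dilate-0 f)) (reflexive (dilate-0 g))) ⟩
        f 0 * g 0 + 0#
          ≡⟨ dilate-0 (convolution f g) ⟨
        dilate r (convolution f g) 0 ∎
      step (suc n) ih f | inj₁ n<r =
        trans (dilate-*-< f g n n<r) (sym (reflexive (dilate-< (convolution f g) n<r)))
      step n       ih f | inj₂ r≤n with m , ≡.refl ← ℕP.m≤n⇒∃[o]m+o≡n r≤n = high m ih f

-- Identities between quotients, with denominators cleared.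

module CrossMultiplication {a ℓ : Level} (R : CommutativeRing a ℓ) where
  open CommutativeRing R
  open SetoidReasoning setoid
  open NatCoeffSolver commutativeSemiring using (solve; _:=_; _:+_; _:*_)

  cross-+ : ∀ {m d g m′ d′ g′} → m ≈ d * g → m′ ≈ d′ * g′ → m * d′ + m′ * d ≈ (d * d′) * (g + g′)
  cross-+ {d = d} {g} {d′ = d′} {g′} p p′ = trans (+-cong (*-congʳ p) (*-congʳ p′))
    (solve 4 (λ d g d′ g′ → (d :* g) :* d′ :+ (d′ :* g′) :* d := (d :* d′) :* (g :+ g′)) refl d g d′ g′)

  cross-* : ∀ {m d g m′ d′ g′} → m ≈ d * g → m′ ≈ d′ * g′ → m * m′ ≈ (d * d′) * (g * g′)
  cross-* {d = d} {g} {d′ = d′} {g′} p p′ = trans (*-cong p p′)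
    (solve 4 (λ d g d′ g′ → (d :* g) :* (d′ :* g′) := (d :* d′) :* (g :* g′)) refl d g d′ g′)

  cross-respects : ∀ {m d g m′ d′} → m ≈ d * g → m * d′ ≈ m′ * d → m′ * d ≈ (d′ * g) * d
  cross-respects {d = d} {g} {d′ = d′} p eq = trans (sym eq) (trans (*-congʳ p)
    (solve 3 (λ d g d′ → (d :* g) :* d′ := (d′ :* g) :* d) refl d g d′))

  -- This is (m/d)(m₁/d₁) = m₂/d₂ solved for m/d. The factor d₁d₂ stays on both sides, to be
  -- cancelled where the ring is a domain.
  cross-quotient : ∀ {m d m₁ d₁ g₁ m₂ d₂ g₂ i} → (m * m₁) * d₂ ≈ m₂ * (d * d₁) →
    m₁ ≈ d₁ * g₁ → m₂ ≈ d₂ * g₂ → g₁ * i ≈ 1# → m * (d₁ * d₂) ≈ (d * (g₂ * i)) * (d₁ * d₂)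
  cross-quotient {m} {d} {m₁} {d₁} {g₁} {m₂} {d₂} {g₂} {i} eq p₁ p₂ g₁i≈1 = begin
    m * (d₁ * d₂)                 ≈⟨ *-identityʳ _ ⟨
    (m * (d₁ * d₂)) * 1#          ≈⟨ *-congˡ g₁i≈1 ⟨
    (m * (d₁ * d₂)) * (g₁ * i)    ≈⟨ solve 5 (λ m d₁ d₂ g i → (m :* (d₁ :* d₂)) :* (g :* i)
                                       := ((m :* (d₁ :* g)) :* d₂) :* i) refl m d₁ d₂ g₁ i ⟩
    ((m * (d₁ * g₁)) * d₂) * i    ≈⟨ *-congʳ (*-congʳ (*-congˡ p₁)) ⟨
    ((m * m₁) * d₂) * i           ≈⟨ *-congʳ eq ⟩
    (m₂ * (d * d₁)) * i           ≈⟨ *-congʳ (*-congʳ p₂) ⟩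
    ((d₂ * g₂) * (d * d₁)) * i    ≈⟨ solve 5 (λ d d₁ d₂ g i → ((d₂ :* g) :* (d :* d₁)) :* i
                                       := (d :* (g :* i)) :* (d₁ :* d₂)) refl d d₁ d₂ g₂ i ⟩
    (d * (g₂ * i)) * (d₁ * d₂)    ∎

  cross-factor : ∀ e x v y w → (e * x - v * (e * y)) * w ≈ e * (x * w - v * (y * w))
  cross-factor e x v y w = begin
    (e * x - v * (e * y)) * w           ≈⟨ [y-z]x≈yx-zx w (e * x) (v * (e * y)) ⟩
    (e * x) * w - (v * (e * y)) * w     ≈⟨ +-cong (*-assoc e x w) (-‿cong
      (solve 4 (λ e v y w → (v :* (e :* y)) :* w := e :* (v :* (y :* w))) refl e v y w)) ⟩
    e * (x * w) - e * (v * (y * w))     ≈⟨ x[y-z]≈xy-xz e (x * w) (v * (y * w)) ⟨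
    e * (x * w - v * (y * w))           ∎
    where open RingProperties ring using (x[y-z]≈xy-xz; [y-z]x≈yx-zx)

  -- If h₀ is inverse to e, then m/d = eh is the ratio h/h₀; so a prefactor of a moment becomes the
  -- denominator of a ratio of series.
  cross-swap : ∀ {m d e h h₀} → m ≈ d * (e * h) → e * h₀ ≈ 1# → h * d ≈ h₀ * m
  cross-swap {m} {d} {e} {h} {h₀} p eh₀≈1 = begin
    h * d                   ≈⟨ *-identityˡ _ ⟨
    1# * (h * d)            ≈⟨ *-congʳ eh₀≈1 ⟨
    (e * h₀) * (h * d)      ≈⟨ solve 4 (λ e g h d → (e :* g) :* (h :* d) := g :* (d :* (e :* h))) refl e h₀ h d ⟩
    h₀ * (d * (e * h))      ≈⟨ *-congˡ p ⟨
    h₀ * m                  ∎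

-- Expansion of rational functions at 0.

module Expansion {a ℓ : Level} (K : DiscreteField a ℓ) where
  open DiscreteField K
  module RF = RationalFunctions K
  module LS = LaurentSeries K
  module F  = DiscreteField RF.rationalFunctionField
  open RF using (Fraction; Polynomial; num; den; den≉0; coeff; poly≈; series≈; cross; embed; const; 1ₚ; X)
  open LS using (Series; _≋_; coeffwise; at; convolution; one; sum-0)
  open SeriesLemmas commutativeRing using (module S; tail)
  open CrossMultiplication LS.seriesRing
  open RawSemiringOps (Semiring.rawSemiring S.semiring) using () renaming (_^_ to _S^_)

  -- f ~ g: the series g is the expansion of the rational function f at 0.
  infix 4 _~_
  record _~_ (f : Fraction) (g : Series) : Set ℓ where
    constructor expands
    field expansion : coeff (num f) ≋ convolution (coeff (den f)) g
  open _~_ public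

  den-series≉0 : ∀ f → ¬ (coeff (den f) ≋ S.0#)
  den-series≉0 f d≈0 = den≉0 f (poly≈ d≈0)

  ~-cong : ∀ {f g g′} → g ≋ g′ → f ~ g → f ~ g′
  ~-cong {f} g≋g′ (expands p) = expands (S.trans p (S.*-congˡ {coeff (den f)} g≋g′))

  ~-respects : ∀ {f f′ g} → f F.≈ f′ → f ~ g → f′ ~ g
  ~-respects {f} {f′} {g} (cross eq) (expands p) = expands
    (LS.*-cancelʳ (coeff (den f)) (den-series≉0 f)
      (cross-respects {coeff (num f)} {coeff (den f)} {g} {coeff (num f′)} {coeff (den f′)} p (series≈ eq)))

  ~-unique : ∀ {f g g′} → f ~ g → f ~ g′ → g ≋ g′
  ~-unique {f} {g} {g′} (expands p) (expands p′) = LS.*-cancelʳ (coeff (den f)) (den-series≉0 f)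
    (S.trans (S.*-comm g _) (S.trans (S.sym p) (S.trans p′ (S.*-comm _ g′))))

  ~-+ : ∀ {f f′ g g′} → f ~ g → f′ ~ g′ → f F.+ f′ ~ g S.+ g′
  ~-+ {f} {f′} {g} {g′} (expands p) (expands p′) = expands
    (cross-+ {coeff (num f)} {coeff (den f)} {g} {coeff (num f′)} {coeff (den f′)} {g′} p p′)

  ~-* : ∀ {f f′ g g′} → f ~ g → f′ ~ g′ → f F.* f′ ~ g S.* g′
  ~-* {f} {f′} {g} {g′} (expands p) (expands p′) = expands
    (cross-* {coeff (num f)} {coeff (den f)} {g} {coeff (num f′)} {coeff (den f′)} {g′} p p′)

  ~-neg : ∀ {f g} → f ~ g → F.- f ~ S.- g
  ~-neg {f} {g} (expands p) = expands (S.trans (S.-‿cong p) (-‿distribʳ-* (coeff (den f)) g))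
    where open RingProperties S.ring using (-‿distribʳ-*)

  ~-embed : ∀ f → embed f ~ coeff f
  ~-embed f = expands (S.sym (S.*-identityˡ (coeff f)))

  -- That f has an expansion at all is part of the conclusion; an explicit inverse i of the series
  -- of the divisor is enough.
  ~-quotient : ∀ {f f₁ f₂ g₁ g₂ i} → f F.* f₁ F.≈ f₂ → f₁ ~ g₁ → f₂ ~ g₂ → g₁ S.* i ≋ one → f ~ g₂ S.* i
  ~-quotient {f} {f₁} {f₂} (cross eq) (expands p₁) (expands p₂) g₁i≋1 = expands
    (LS.*-cancelʳ (coeff (den f₁) S.* coeff (den f₂)) (LS.*≉0 (den-series≉0 f₁) (den-series≉0 f₂))
      (cross-quotient {m = coeff (num f)} {d = coeff (den f)} (series≈ eq) p₁ p₂ g₁i≋1))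

  C : Carrier → Series
  C x = coeff (const x)

  C-* : ∀ x f n → (C x S.* f) n ≈ x * f n
  C-* x f n = trans (+-congˡ (sum-0 {n} _ (λ i → zeroˡ _))) (+-identityʳ _)

  1~one : F.1# ~ one
  1~one = ~-embed 1ₚ

  ~-^ : ∀ {f g} → f ~ g → ∀ n → f F.^ n ~ g S^ n
  ~-^ f~g zero    = 1~one
  ~-^ f~g (suc n) = ~-* f~g (~-^ f~g n)

  C-1 : C 1# ≋ one
  C-1 = coeffwise λ { zero → refl ; (suc _) → refl }

  C-^ : ∀ x n → C x S^ n ≋ C (x ^ n)
  C-^ x zero    = S.sym C-1
  C-^ x (suc n) = S.trans (S.*-congˡ {C x} (C-^ x n))
    (coeffwise λ m → trans (C-* x (C (x ^ n)) m) (pointwise m))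
    where
    pointwise : ∀ m → x * C (x ^ n) m ≈ C (x * x ^ n) m
    pointwise zero    = refl
    pointwise (suc m) = zeroʳ x

  ~-C-^ : ∀ {f x} → f ~ C x → ∀ n → f F.^ n ~ C (x ^ n)
  ~-C-^ {x = x} f~x n = ~-cong (C-^ x n) (~-^ f~x n)

  X-* : ∀ f n → (coeff X S.* f) (suc n) ≈ f n
  X-* f n = trans (+-cong (zeroˡ _) (at (S.*-congʳ {f} tailX) n)) (trans (+-identityˡ _) (at (S.*-identityˡ f) n))
    where
    tailX : tail (coeff X) ≋ one
    tailX = coeffwise λ { zero → refl ; (suc _) → refl }

  X-*-0 : ∀ f → (coeff X S.* f) 0 ≈ 0#
  X-*-0 f = trans (+-identityʳ _) (zeroˡ _)

  embedX≉0 : ¬ (embed X F.≈ F.0#)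
  embedX≉0 X≈0 = 1≉0 (at (~-unique (~-respects X≈0 (~-embed X)) (~-embed RF.0ₚ)) 1)

  -- The constant terms of the two expansions are 0 and 1. Over ℚ this says that q is not a root of
  -- unity.
  embedX^k≉1 : ∀ k .{{_ : NonZero k}} → ¬ (embed X F.^ k F.≈ F.1#)
  embedX^k≉1 (suc k) Xᵏ≈1 = 1≉0 (trans
    (sym (at (~-unique (~-respects Xᵏ≈1 (~-^ (~-embed X) (suc k))) 1~one) 0))
    (X-*-0 (coeff X S^ k)))

  geometric : ∀ u → (one S.- coeff X S.* C u) S.* (u ^_) ≋ one
  geometric u = S.trans ([y-z]x≈yx-zx (u ^_) one (coeff X S.* C u)) (S.trans
    (S.+-cong (S.*-identityˡ (u ^_)) (S.-‿cong (S.*-assoc (coeff X) (C u) (u ^_)))) (coeffwise go))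
    where
    open RingProperties S.ring using ([y-z]x≈yx-zx)
    open RingProperties ring using (-0#≈0#)
    go : ∀ n → ((u ^_) S.- coeff X S.* (C u S.* (u ^_))) n ≈ one n
    go zero    = trans (+-congˡ (trans (-‿cong (X-*-0 (C u S.* (u ^_)))) -0#≈0#)) (+-identityʳ 1#)
    go (suc n) = trans (+-congˡ (-‿cong (trans (X-* (C u S.* (u ^_)) n) (C-* u (u ^_) n)))) (-‿inverseʳ _)

-- The affine change of variable between x and y.

module ShiftedVariable {a ℓ : Level} (F : DiscreteField a ℓ) where
  open DiscreteField F

  module Affine (s v w : Carrier) (vw≈1 : v * w ≈ 1#) where
    open Polynomials commutativeRing
    open PowerSeries commutativeRing using (coeffwise)
    open PolynomialLemmas commutativeRing

    Y : Polynomial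
    Y = w • (1ₚ +ₚ (s - 1#) • X)

    [1-s]X+vY≈1 : (1# - s) • X +ₚ v • Y ≈ₚ 1ₚ
    [1-s]X+vY≈1 = P.trans (P.+-congˡ {(1# - s) • X} (P.trans (•-assoc v w (1ₚ +ₚ (s - 1#) • X))
              (P.trans (•-cong vw≈1 P.refl) (•-identity (1ₚ +ₚ (s - 1#) • X)))))
            (poly≈ (coeffwise (λ n → pointwise (coeff X n) (coeff 1ₚ n))))
      where
      open SetoidReasoning setoid
      open NatCoeffSolver commutativeSemiring using (solve; _:=_; _:+_; _:*_)
      pointwise : ∀ x o → (1# - s) * x + (o + (s - 1#) * x) ≈ o
      pointwise x o = begin
        (1# - s) * x + (o + (s - 1#) * x)
          -- The solver works over semirings, so the negatives of s and of 1 enter as the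
          -- independent atoms m and e′.
          ≈⟨ solve 6 (λ e s m e′ x o → (e :+ m) :* x :+ (o :+ (s :+ e′) :* x)
               := o :+ ((e :+ e′) :+ (s :+ m)) :* x) refl 1# s (- s) (- 1#) x o ⟩
        o + ((1# - 1#) + (s - s)) * x
          ≈⟨ +-congˡ (*-congʳ (trans (+-cong (-‿inverseʳ 1#) (-‿inverseʳ s)) (+-identityʳ 0#))) ⟩
        o + 0# * x
          ≈⟨ trans (+-congˡ (zeroˡ x)) (+-identityʳ o) ⟩
        o ∎

    module _ {φ : Polynomial → Carrier}
      (isLinear : LeftModuleMorphisms.IsLeftModuleHomomorphism rawLeftModule
                    (TensorUnit.rawLeftModule {R = Ring.rawRing ring}) φ) where
      open Linear isLinear

      mixedMoment : ℕ → ℕ → Carrier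
      mixedMoment n k = φ (X ^ₚ n *ₚ Y ^ₚ k)

      -- The affine relation `[1-s]X+vY≈1` is multiplied by xⁿyᵏ before φ is applied.
      mixedMoment-recurrence : ∀ n k →
        (1# - s) * mixedMoment (suc n) k + v * mixedMoment n (suc k) ≈ mixedMoment n k
      mixedMoment-recurrence n k = begin
        (1# - s) * φ (X ^ₚ suc n *ₚ Y ^ₚ k) + v * φ (X ^ₚ n *ₚ Y ^ₚ suc k)
          ≈⟨ +-cong (*-congˡ (φ-cong (xy∙z≈yz∙x X (X ^ₚ n) (Y ^ₚ k))))
                    (*-congˡ (φ-cong (x∙yz≈xz∙y (X ^ₚ n) Y (Y ^ₚ k)))) ⟩
        (1# - s) * φ (U *ₚ X) + v * φ (U *ₚ Y)
          ≈⟨ +-cong (φ-• (1# - s) (U *ₚ X)) (φ-• v (U *ₚ Y)) ⟨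
        φ ((1# - s) • (U *ₚ X)) + φ (v • (U *ₚ Y))
          ≈⟨ φ-+ _ _ ⟨
        φ ((1# - s) • (U *ₚ X) +ₚ v • (U *ₚ Y))
          ≈⟨ φ-cong (P.+-cong (*ₚ-•-comm (1# - s) U X) (*ₚ-•-comm v U Y)) ⟨
        φ (U *ₚ ((1# - s) • X) +ₚ U *ₚ (v • Y))
          ≈⟨ φ-cong (P.distribˡ U ((1# - s) • X) (v • Y)) ⟨
        φ (U *ₚ ((1# - s) • X +ₚ v • Y))
          ≈⟨ φ-cong (P.trans (P.*-congˡ {U} [1-s]X+vY≈1) (P.*-identityʳ U)) ⟩
        φ U ∎
        where
        open SetoidReasoning setoid
        open CommutativeSemigroupProperties
          (CommutativeRing.*-commutativeSemigroup polynomialRing) using (xy∙z≈yz∙x; x∙yz≈xz∙y)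
        U = X ^ₚ n *ₚ Y ^ₚ k

-- The L-series as a sum over an arithmetic progression.

module Progression {a ℓ : Level} (K : DiscreteField a ℓ) (s : DiscreteField.Carrier K)
  (c r : ℕ) .{{_ : NonZero r}} where
  open DiscreteField K
  open LSeries K s using ([_]; L)
  open PowerSeries commutativeRing
  open SeriesLemmas commutativeRing
  open SemiringExp semiring using (^-homo-*; ^-assocʳ)

  -- The case k = 0 gives L; a general k is what closes the recurrence H-suc in n.
  H : ℕ → ℕ → Series
  H n k j = [ c ℕ.+ r ℕ.* j ] ^ n * ((s ^ r) ^ k) ^ j

  -- Raising k by one multiplies the j-th coefficient by sʳʲ, so the difference has the factor (1 -
  -- sᶜ⁺ʳʲ)/(1 - s), which is the bracket of c + rj.
  H-suc : ∀ n k j → H n k j * (1# - s) ⁻¹ - s ^ c * (H n (suc k) j * (1# - s) ⁻¹) ≈ H (suc n) k j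
  H-suc n k j = begin
    (x * t) * w - v * ((x * (u * y) ^ j) * w)
      ≈⟨ +-congˡ (-‿cong (*-congˡ (*-congʳ (*-congˡ (^-distrib-* u y j))))) ⟩
    (x * t) * w - v * ((x * (u ^ j * t)) * w)
      ≈⟨ +-congˡ (-‿cong (solve 5 (λ x t w v y → v :* ((x :* (y :* t)) :* w)
                                  := (v :* y) :* ((x :* t) :* w)) refl x t w v (u ^ j))) ⟩
    (x * t) * w - (v * u ^ j) * ((x * t) * w)
      ≈⟨ +-cong (sym (*-identityˡ _)) (-‿cong (*-congʳ exponent)) ⟩
    1# * ((x * t) * w) - s ^ m * ((x * t) * w)
      ≈⟨ [y-z]x≈yx-zx _ _ _ ⟨
    (1# - s ^ m) * ((x * t) * w)
      ≈⟨ solve 4 (λ d x t w → d :* ((x :* t) :* w) := ((d :* w) :* x) :* t) refl (1# - s ^ m) x t w ⟩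
    ([ m ] * x) * t ∎
    where
    open SetoidReasoning setoid
    open NatCoeffSolver commutativeSemiring using (solve; _:=_; _:*_)
    open RingProperties ring using ([y-z]x≈yx-zx)
    open CommutativeSemiringExp commutativeSemiring using (^-distrib-*)
    m = c ℕ.+ r ℕ.* j
    x = [ m ] ^ n
    u = s ^ r
    y = u ^ k
    t = y ^ j
    v = s ^ c
    w = (1# - s) ⁻¹
    exponent : v * u ^ j ≈ s ^ m
    exponent = trans (*-congˡ (^-assocʳ s r j)) (sym (^-homo-* s c (r ℕ.* j)))

  -- A positive exponent m below c has 0 < c - m < r, as c ≤ r, so it is not in the residue class.
  -- The exponent 0, where `L` is 0 by definition, lies below c because 1 ≤ c.
  L-shift : 1 ℕ.≤ c → c ℕ.≤ r → ∀ n → L (+ c) r n ≋ shift c (dilate r (H n 0))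
  L-shift 1≤c c≤r n = coeffwise go
    where
    f : Series
    f = dilate r (H n 0)

    low : ∀ m → m ℕ.< c → L (+ c) r n m ≡ 0#
    low zero    _   = ≡.refl
    low (suc m) m<c
      rewrite dec-false (r ℕ∣.∣? ℤ.∣ + suc m ℤ.- + c ∣) (λ r∣ → ℕ∣.>⇒∤ {{ℕ.>-nonZero (ℕP.m<n⇒0<n∸m m<c)}}
        (ℕP.<-≤-trans (ℕP.∸-monoʳ-< {c} (s≤s z≤n) (ℕP.<⇒≤ m<c)) c≤r)
        (≡.subst (r ℕ∣.∣_) (≡.trans (≡.cong ℤ.∣_∣ (ℤP.[+m]-[+n]≡m⊖n (suc m) c)) (ℤP.∣⊖∣-≤ (ℕP.<⇒≤ m<c))) r∣))
      = ≡.refl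

    high : ∀ m i → suc m ≡ c ℕ.+ i → L (+ c) r n (suc m) ≈ f i
    high m i eq = trans
      (reflexive (≡.cong (λ d → if does (r ℕ∣.∣? d) then [ suc m ] ^ n else 0#) diff)) value
      where
      diff : ℤ.∣ + suc m ℤ.- + c ∣ ≡ i
      diff = ≡.trans (≡.cong ℤ.∣_∣ (≡.trans (ℤP.[+m]-[+n]≡m⊖n (suc m) c) (ℤP.⊖-≥ (≡.subst (c ℕ.≤_) (≡.sym eq) (ℕP.m≤m+n c i)))))
        (≡.trans (≡.cong (ℕ._∸ c) eq) (ℕP.m+n∸m≡n c i))

      -- At k = 0 the second factor of `H` is a power of 1.
      1^ : ∀ j → 1# ^ j ≈ 1#
      1^ zero    = refl
      1^ (suc j) = trans (*-identityˡ _) (1^ j)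

      value : (if does (r ℕ∣.∣? i) then [ suc m ] ^ n else 0#) ≈ f i
      value with r ℕ∣.∣? i
      ... | no  _   = refl
      ... | yes r∣i = trans (sym (*-identityʳ _)) (*-cong
        (reflexive (≡.cong (λ j → [ j ] ^ n) (≡.trans eq (≡.cong (c ℕ.+_) (≡.sym (ℕ/.m*[n/m]≡n r∣i))))))
        (sym (1^ (i ℕ./ r))))

    go : ∀ m → L (+ c) r n m ≈ shift c f m
    go m with ℕP.<-≤-connex m c
    go m | inj₁ m<c = reflexive (≡.trans (low m m<c) (≡.sym (shift-< c f m<c)))
    go m | inj₂ c≤m with i , ≡.refl ← ℕP.m≤n⇒∃[o]m+o≡n c≤m =
      trans (aux (c ℕ.+ i) ≡.refl (ℕP.≤-trans 1≤c c≤m)) (sym (reflexive (shift-+ c f i)))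
      where
      aux : ∀ m → m ≡ c ℕ.+ i → 1 ℕ.≤ m → L (+ c) r n m ≈ f i
      aux (suc m) eq _ = high m i eq

-- Comparison of the moments with the L-series.

module MomentTheorem {a ℓ : Level} (K : DiscreteField a ℓ) where
  open DiscreteField K

  module Generic (s : Carrier)
    (s≉0 : ¬ (s ≈ 0#)) (sᵏ≉1 : ∀ k .{{_ : NonZero k}} → ¬ (s ^ k ≈ 1#))
    (c r : ℕ) .{{_ : NonZero r}} (1≤c : 1 ℕ.≤ c) (c≤r : c ℕ.≤ r) where
    open Expansion K
    open RF using (embed; const; X; num; den; coeff)
    open LS using (_≋_; coeffwise; at; one; dilate)
    open SeriesLemmas commutativeRing using (module S; shift; shift-cong; shift-*; dilate-homo-*; dilate-cong; dilate-one)
    open Progression K s c r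
    open LSeries K s using (L)
    open RingLemmas commutativeRing using (x≉y⇒x-y≉0)
    open SemiringExp semiring using (^-assocʳ)
    private
      module FL = FieldLemmas RF.rationalFunctionField
      module FR = RingLemmas F.commutativeRing

    s′ Z′ p α : F.Carrier
    s′ = embed (const s)
    Z′ = embed X
    p  = s′ F.^ r
    α  = Z′ F.* s′ F.^ℤ (ℤ.- (+ r))

    s′~s : s′ ~ C s
    s′~s = ~-embed (const s)

    pᵏ~ : ∀ k → p F.^ k ~ C ((s ^ r) ^ k)
    pᵏ~ = ~-C-^ (~-C-^ s′~s r)

    s′≉0 : ¬ (s′ F.≈ F.0#)
    s′≉0 s′≈0 = s≉0 (at (~-unique (~-respects s′≈0 s′~s) (~-embed RF.0ₚ)) 0)

    p≉0 : ¬ (p F.≈ F.0#)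
    p≉0 = FL.^≉0 s′≉0 r

    pᵏ≉1 : ∀ k → ¬ (p F.^ suc k F.≈ F.1#)
    pᵏ≉1 k pᵏ≈1 = sᵏ≉1 (r ℕ.* suc k) {{ℕP.m*n≢0 r (suc k)}}
      (trans (sym (^-assocʳ s r (suc k))) (at (~-unique (~-respects pᵏ≈1 (pᵏ~ (suc k))) 1~one) 0))

    αp≈Z : α F.* p F.≈ Z′
    αp≈Z = F.trans (F.*-assoc Z′ _ p) (F.trans (F.*-congˡ {Z′} (FL.^ℤ-neg-inverseˡ s′≉0 r)) (F.*-identityʳ Z′))

    αpᵏ~ : ∀ k → (α F.* p) F.* p F.^ k ~ coeff X S.* C ((s ^ r) ^ k)
    αpᵏ~ k = ~-* (~-respects (F.sym αp≈Z) (~-embed X)) (pᵏ~ k)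

    -- Z is an indeterminate: the expansion of Zpᵏ has constant term 0.
    αpᵏ≉1 : ∀ k → ¬ ((α F.* p) F.* p F.^ k F.≈ F.1#)
    αpᵏ≉1 k αpᵏ≈1 = 1≉0 (trans (sym (at (~-unique (~-respects αpᵏ≈1 (αpᵏ~ k)) 1~one) 0))
      (X-*-0 (C ((s ^ r) ^ k))))

    E : LS.Series
    E = one S.- coeff X

    1-αp~E : F.1# F.- α F.* p ~ E
    1-αp~E = ~-+ 1~one (~-neg (~-respects (F.sym αp≈Z) (~-embed X)))

    module Jacobi = LittleQJacobiMoments.Generic RF.rationalFunctionField p α p≉0 pᵏ≉1 αpᵏ≉1
    module Shifted = ShiftedVariable.Affine RF.rationalFunctionField s′ (s′ F.^ c) (s′ F.^ℤ (ℤ.- (+ c)))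
      (F.trans (F.*-comm (s′ F.^ c) _) (FL.^ℤ-neg-inverseˡ s′≉0 c))

    module FP = Polynomials F.commutativeRing
    module FPL = PolynomialLemmas F.commutativeRing
    module FO = Orthogonality RF.rationalFunctionField

    module _ {φ : FP.Polynomial → F.Carrier}
      (isMoment : FO.IsMomentFunctional (LittleQJacobi.shiftedLittleQJacobi RF.rationalFunctionField s′ Z′ (+ c) r) φ)
      where
      open FO.IsMomentFunctional isMoment
      open FPL.Linear isLinear

      M : ℕ → ℕ → F.Carrier
      M = Shifted.mixedMoment isLinear

      1-s≉0 : ¬ (1# - s ≈ 0#)
      1-s≉0 = x≉y⇒x-y≉0 (λ 1≈s → sᵏ≉1 1 (trans (*-identityʳ s) (sym 1≈s)))

      -- Two uses of `~-quotient`: the divisor is 1 - Zpᵏ with a geometric series as inverse for n =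
      -- 0, and the constant 1 - s afterwards. The step for k uses n at k and k + 1.
      mixedMoment~ : ∀ n k → M n k ~ E S.* H n k
      mixedMoment~ zero k = ~-cong (S.*-congˡ {E} (coeffwise (λ j → sym (*-identityˡ _))))
        (~-quotient
          (F.trans (F.*-congʳ {F.1# F.- (α F.* p) F.* p F.^ k} (φ-cong (FPL.P.*-identityˡ (Shifted.Y FPL.^ₚ k))))
                   (Jacobi.φ-^-*-1-αpᵏ Shifted.Y isMoment k))
          (~-+ 1~one (~-neg (αpᵏ~ k))) 1-αp~E (geometric ((s ^ r) ^ k)))
      mixedMoment~ (suc n) k = ~-cong series-step
        (~-quotient
          (F.trans (F.*-comm (M (suc n) k) (F.1# F.- s′)) (FR.x+y≈z⇒x≈z-y (Shifted.mixedMoment-recurrence isLinear n k)))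
          (~-+ 1~one (~-neg s′~s))
          (~-+ (mixedMoment~ n k) (~-neg (~-* (~-C-^ s′~s c) (mixedMoment~ n (suc k)))))
          1-s*w≋1)
        where
        w = (1# - s) ⁻¹
        1-s*w≋1 : (one S.- C s) S.* C w ≋ one
        1-s*w≋1 = S.trans (S.*-congʳ {C w} one-Cs≋C) (coeffwise λ m → trans (C-* (1# - s) (C w) m) (pointwise m))
          where
          open RingProperties ring using (-0#≈0#)
          one-Cs≋C : one S.- C s ≋ C (1# - s)
          one-Cs≋C = coeffwise λ { zero → refl ; (suc _) → trans (+-identityˡ _) -0#≈0# }
          pointwise : ∀ m → (1# - s) * C w m ≈ one m
          pointwise zero    = *-inverse (1# - s) 1-s≉0
          pointwise (suc m) = zeroʳ _
        series-step : (E S.* H n k S.- C (s ^ c) S.* (E S.* H n (suc k))) S.* C w ≋ E S.* H (suc n) k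
        series-step = S.trans
          (CrossMultiplication.cross-factor LS.seriesRing E (H n k) (C (s ^ c)) (H n (suc k)) (C w))
          (S.*-congˡ {E} (coeffwise λ j → trans
            (+-cong (*-C (H n k) j) (-‿cong (trans (C-* (s ^ c) (H n (suc k) S.* C w) j) (*-congˡ (*-C (H n (suc k)) j)))))
            (H-suc n k j)))
          where
          *-C : ∀ f j → (f S.* C w) j ≈ f j * w
          *-C f j = trans (at (S.*-comm f (C w)) j) (trans (C-* w f j) (*-comm w (f j)))

      moment~ : ∀ n → FO.moment φ n ~ E S.* H n 0
      moment~ n = ~-respects (φ-cong (FPL.P.*-identityʳ (FP.X FPL.^ₚ n))) (mixedMoment~ n 0)

      -- The zeroth moment is 1 by normalisation, and expansions are unique.
      E*H₀≋1 : E S.* H 0 0 ≋ one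
      E*H₀≋1 = ~-unique (moment~ 0) (~-respects (F.sym normalised) 1~one)

      -- Both L-series are zᶜ times a dilated series; with zᶜ moved outside the products, the
      -- cross-multiplied equation reduces to `numerator`.
      L/L₀≈moment : ∀ n → LSeries.L/L₀ K s (+ c) r n LS.≈ᶠ Substitution.atZ=z^ K r (FO.moment φ n)
      L/L₀≈moment n = LS.cross (begin
        L (+ c) r n S.* d (den μ)
          ≈⟨ S.*-congʳ {d (den μ)} (L-shift 1≤c c≤r n) ⟩
        shift c (δ (H n 0)) S.* d (den μ)
          ≈⟨ shift-* c (δ (H n 0)) (d (den μ)) ⟩
        shift c (δ (H n 0) S.* d (den μ))
          ≈⟨ shift-cong c numerator ⟩
        shift c (δ (H 0 0) S.* d (num μ))
          ≈⟨ shift-* c (δ (H 0 0)) (d (num μ)) ⟨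
        shift c (δ (H 0 0)) S.* d (num μ)
          ≈⟨ S.*-congʳ {d (num μ)} (L-shift 1≤c c≤r 0) ⟨
        L (+ c) r 0 S.* d (num μ)
          ≈⟨ S.*-comm (L (+ c) r 0) (d (num μ)) ⟩
        d (num μ) S.* L (+ c) r 0 ∎)
        where
        open SetoidReasoning S.setoid
        μ = FO.moment φ n
        δ : LS.Series → LS.Series
        δ = dilate r
        d : RF.Polynomial → LS.Series
        d f = δ (coeff f)
        -- The expansion of the moment after the substitution Z = zʳ.
        num≋ : d (num μ) ≋ d (den μ) S.* (δ E S.* δ (H n 0))
        num≋ = S.trans (dilate-cong r (_~_.expansion (moment~ n)))
          (S.trans (S.sym (dilate-homo-* r (coeff (den μ)) (E S.* H n 0)))
            (S.*-congˡ {d (den μ)} (S.sym (dilate-homo-* r E (H n 0)))))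
        E*H₀≋1′ : δ E S.* δ (H 0 0) ≋ one
        E*H₀≋1′ = S.trans (dilate-homo-* r E (H 0 0)) (S.trans (dilate-cong r E*H₀≋1) (dilate-one r))
        numerator : δ (H n 0) S.* d (den μ) ≋ δ (H 0 0) S.* d (num μ)
        numerator = CrossMultiplication.cross-swap LS.seriesRing
            {d (num μ)} {d (den μ)} {δ E} {δ (H n 0)} {δ (H 0 0)} num≋ E*H₀≋1′

mainTheorem3 : (c : ℤ) (r : ℕ) .{{_ : NonZero r}} → + 1 ≤ c → c ≤ + r →
    (φ : ℚ⟨q,Z⟩[x].Polynomial → ℚ⟨q,Z⟩.Fraction) →
    IsMomentFunctional (shiftedLittleQJacobi q′ Z c r) φ →
    (n : ℕ) →
    L/L₀ c r n ℚ⟨q⟩⟨⟨z⟩⟩.≈ᶠ atZ=z^ r (moment φ n)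
-- One clause suffices, since + 1 ≤ c is empty for negative c.
mainTheorem3 (+ c) r 1≤c c≤r φ isMoment n =
  L/L₀≈moment isMoment n
  where
  -- ℚ(q) is itself a field of rational functions, so the facts about its indeterminate q come from
  -- expansions over ℚ.
  open Expansion ℚ-field using (embedX≉0; embedX^k≉1)
  open MomentTheorem.Generic ℚ⟨q⟩-field q embedX≉0 embedX^k≉1 c r (ℤP.drop‿+≤+ 1≤c) (ℤP.drop‿+≤+ c≤r)
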